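{- Let $a:(-\infty,t_{\max}]\to\mathbb{R}$ be an arrival time function with first breakpoint at $t_{\min}$ and $b_a$ breakpoints. Let $c_a:[t_{\min},t_{\max}]\to\mathbb{R}$ be a piecewise constant, lower semi-continuous function with $b_{c_a}$ breakpoints (discontinuities); let $c_{\mathrm{ot}}:[0,\infty)\to\mathbb{R}$ be a piecewise linear, continuous, non-decreasing function with $b_{c_{\mathrm{ot}}}$ breakpoints; and let $c_{\mathrm{wt}}$ be a piecewise constant function on $[t_{\min},a(t_{\max})]$ with $b_{c_{\mathrm{wt}}}$ breakpoints. Define for $t_0\in[t_{\min},t_{\max}]$ $$c_{\mathrm{tot}}(t_0):=c_a(t_0)+c_{\mathrm{ot}}\big(a(t_0)-t_0\big)+\int_{t_0}^{a(t_0)}c_{\mathrm{wt}}(t)\,\mathrm{d}t.$$ Then the least $t_0\in[t_{\min},t_{\max}]$ minimizing $c_{\mathrm{tot}}$ can be computed in $O(b_{c_{\mathrm{ot}}}b_a+b_{c_a}+b_{c_{\mathrm{wt}}})$ time.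
   Context: An arrival time function (ATF) is a piecewise linear function $a:(-\infty,t_{\max}]\to\mathbb{R}$ such that $a$ is continuous, non-decreasing, $a(t)\ge t$ for all $t\le t_{\max}$, and $a$ is constant on $(-\infty,t_{\min}]$ for some $t_{\min}\le t_{\max}$; it is represented by its sorted breakpoint list $(t_i,a(t_i))$, $t_1=t_{\min}<\dots<t_b=t_{\max}$, and then has $b$ breakpoints. All functions are given by their sorted lists of breakpoints/pieces. -}

module Defs where

open import Algebra.Bundles using (CommutativeRing)
open import Algebra.Core using (Op₁; Op₂)
open import Algebra.Structures using (IsCommutativeRing)
import Algebra.Construct.NaturalChoice.Max as Max
import Algebra.Construct.NaturalChoice.Min as Min
open import Data.List.Base as List using (List; []; _∷_)
open import Data.List.Membership.Propositional using (_∈_)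
open import Data.List.NonEmpty.Base as List⁺ using (List⁺; _∷_)
open import Data.List.Relation.Unary.All as All using (All; []; _∷_)
open import Data.List.Relation.Unary.Linked using (Linked)
open import Data.Nat.Base as ℕ using (ℕ)
open import Data.Product.Base using (Σ-syntax; _×_; _,_; proj₁; proj₂)
open import Level using (Level; _⊔_; suc)
open import Relation.Binary.Bundles using (DecTotalOrder)
open import Relation.Binary.Core using (Rel)
open import Relation.Binary.Structures using (IsDecTotalOrder)
import Relation.Binary.Construct.NonStrictToStrict as ToStrict
open import Relation.Nullary.Decidable.Core using (yes; no)
open import Relation.Nullary.Negation.Core using (¬_)

------------------------------------------------------------------------
-- Scalars
------------------------------------------------------------------------

-- The standard library has no real numbers, so scalars range over an arbitrary
-- linearly ordered field with decidable order.  Classically ℝ is such a field,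
-- and deciding the order is exactly the comparison instruction of a real RAM.
-- The value of 0# ⁻¹ is left unspecified.
record OrderedField (c ℓ₁ ℓ₂ : Level) : Set (suc (c ⊔ ℓ₁ ⊔ ℓ₂)) where
  infix  9 _⁻¹
  infix  8 -_
  infixl 7 _*_
  infixl 6 _+_
  infix  4 _≈_ _≤_
  field
    Carrier           : Set c
    _≈_               : Rel Carrier ℓ₁
    _≤_               : Rel Carrier ℓ₂
    _+_ _*_           : Op₂ Carrier
    -_ _⁻¹            : Op₁ Carrier
    0# 1#             : Carrier
    isCommutativeRing : IsCommutativeRing _≈_ _+_ _*_ -_ 0# 1#
    isDecTotalOrder   : IsDecTotalOrder _≈_ _≤_
    0≉1               : ¬ 0# ≈ 1#
    *-inverseʳ        : ∀ x → ¬ x ≈ 0# → x * x ⁻¹ ≈ 1#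
    +-monoˡ-≤         : ∀ z {x y} → x ≤ y → x + z ≤ y + z
    *-nonneg          : ∀ {x y} → 0# ≤ x → 0# ≤ y → 0# ≤ x * y

  commutativeRing : CommutativeRing c ℓ₁
  commutativeRing = record { isCommutativeRing = isCommutativeRing }

  decTotalOrder : DecTotalOrder c ℓ₁ ℓ₂
  decTotalOrder = record { isDecTotalOrder = isDecTotalOrder }

  open CommutativeRing commutativeRing public using (_-_)
  open DecTotalOrder decTotalOrder public using (_≟_; _≤?_; totalOrder)
  open ToStrict _≈_ _≤_ public using (_<_)
  open Min totalOrder public using (_⊓_)
  open Max totalOrder public using () renaming (_⊔_ to _⊔ᴷ_)

------------------------------------------------------------------------
-- Algorithms
------------------------------------------------------------------------

-- The model of computation: a strict first-order language over scalars, pairs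
-- and immutable singly linked lists.  Lists and pairs are pointers, contexts
-- are frames of statically known size, so each evaluation step is a bounded
-- number of instructions of a real RAM (unit-cost exact arithmetic and
-- comparison on scalars).

infixr 7 _⊗_

data Ty : Set where
  real : Ty
  _⊗_  : Ty → Ty → Ty
  list : Ty → Ty

Ctx : Set
Ctx = List Ty

infix 3 if_≤_then_else_

data Term : Ctx → Ty → Set where
  var              : ∀ {Γ τ} → τ ∈ Γ → Term Γ τ
  let-in           : ∀ {Γ σ τ} → Term Γ σ → Term (σ ∷ Γ) τ → Term Γ τ
  -- call a closed (non-recursive) procedure
  call             : ∀ {Γ σ τ} → Term (σ ∷ []) τ → Term Γ σ → Term Γ τ
  zero one         : ∀ {Γ} → Term Γ real
  add sub mul div  : ∀ {Γ} → Term Γ real → Term Γ real → Term Γ real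
  if_≤_then_else_  : ∀ {Γ τ} → Term Γ real → Term Γ real →
                     Term Γ τ → Term Γ τ → Term Γ τ
  pair             : ∀ {Γ σ τ} → Term Γ σ → Term Γ τ → Term Γ (σ ⊗ τ)
  fst              : ∀ {Γ σ τ} → Term Γ (σ ⊗ τ) → Term Γ σ
  snd              : ∀ {Γ σ τ} → Term Γ (σ ⊗ τ) → Term Γ τ
  nil              : ∀ {Γ τ} → Term Γ (list τ)
  cons             : ∀ {Γ τ} → Term Γ τ → Term Γ (list τ) → Term Γ (list τ)
  case-list        : ∀ {Γ σ τ} → Term Γ (list σ) →
                     Term Γ τ → Term (σ ∷ list σ ∷ Γ) τ → Term Γ τ
  -- for-each xs s body: starting from state s, traverse xs from its head,
  -- replacing the state by the value of body (element, then state, in scope)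
  for-each         : ∀ {Γ σ τ} → Term Γ (list σ) → Term Γ τ →
                     Term (σ ∷ τ ∷ Γ) τ → Term Γ τ

Program : Ty → Ty → Set
Program σ τ = Term (σ ∷ []) τ

module RealRAM {c ℓ₁ ℓ₂ : Level} (K : OrderedField c ℓ₁ ℓ₂) where

  private module K = OrderedField K

  Val : Ty → Set c
  Val real     = K.Carrier
  Val (σ ⊗ τ)  = Val σ × Val τ
  Val (list τ) = List (Val τ)

  Env : Ctx → Set c
  Env = All Val

  value : ∀ {Γ τ} → Term Γ τ → Env Γ → Val τ
  value (var x)            ρ = All.lookup ρ x
  value (let-in e b)       ρ = value b (value e ρ ∷ ρ)
  value (call p e)         ρ = value p (value e ρ ∷ [])
  value zero               ρ = K.0#
  value one                ρ = K.1#
  value (add e f)          ρ = value e ρ K.+ value f ρ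
  value (sub e f)          ρ = value e ρ K.- value f ρ
  value (mul e f)          ρ = value e ρ K.* value f ρ
  value (div e f)          ρ = value e ρ K.* value f ρ K.⁻¹
  value (if e ≤ f then g else h) ρ with value e ρ K.≤? value f ρ
  ... | yes _ = value g ρ
  ... | no  _ = value h ρ
  value (pair e f)         ρ = value e ρ , value f ρ
  value (fst e)            ρ = proj₁ (value e ρ)
  value (snd e)            ρ = proj₂ (value e ρ)
  value nil                ρ = []
  value (cons e f)         ρ = value e ρ ∷ value f ρ
  value (case-list e f g)  ρ with value e ρ
  ... | []     = value f ρ
  ... | x ∷ xs = value g (x ∷ xs ∷ ρ)
  value (for-each e s b)   ρ =
    List.foldl (λ st x → value b (x ∷ st ∷ ρ)) (value s ρ) (value e ρ)

  loopTime : ∀ {S X : Set c} → (S → X → S) → (S → X → ℕ) → S → List X → ℕ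
  loopTime step cost s []       = 0
  loopTime step cost s (x ∷ xs) =
    1 ℕ.+ cost s x ℕ.+ loopTime step cost (step s x) xs

  -- Number of steps: every construct costs one unit each time it is evaluated,
  -- every loop iteration costs one further unit.
  time : ∀ {Γ τ} → Term Γ τ → Env Γ → ℕ
  time (var x)            ρ = 1
  time (let-in e b)       ρ = 1 ℕ.+ time e ρ ℕ.+ time b (value e ρ ∷ ρ)
  time (call p e)         ρ = 1 ℕ.+ time e ρ ℕ.+ time p (value e ρ ∷ [])
  time zero               ρ = 1
  time one                ρ = 1
  time (add e f)          ρ = 1 ℕ.+ time e ρ ℕ.+ time f ρ
  time (sub e f)          ρ = 1 ℕ.+ time e ρ ℕ.+ time f ρ
  time (mul e f)          ρ = 1 ℕ.+ time e ρ ℕ.+ time f ρ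
  time (div e f)          ρ = 1 ℕ.+ time e ρ ℕ.+ time f ρ
  time (if e ≤ f then g else h) ρ with value e ρ K.≤? value f ρ
  ... | yes _ = 1 ℕ.+ time e ρ ℕ.+ time f ρ ℕ.+ time g ρ
  ... | no  _ = 1 ℕ.+ time e ρ ℕ.+ time f ρ ℕ.+ time h ρ
  time (pair e f)         ρ = 1 ℕ.+ time e ρ ℕ.+ time f ρ
  time (fst e)            ρ = 1 ℕ.+ time e ρ
  time (snd e)            ρ = 1 ℕ.+ time e ρ
  time nil                ρ = 1
  time (cons e f)         ρ = 1 ℕ.+ time e ρ ℕ.+ time f ρ
  time (case-list e f g)  ρ with value e ρ
  ... | []     = 1 ℕ.+ time e ρ ℕ.+ time f ρ
  ... | x ∷ xs = 1 ℕ.+ time e ρ ℕ.+ time g (x ∷ xs ∷ ρ)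
  time (for-each e s b)   ρ =
    1 ℕ.+ time e ρ ℕ.+ time s ρ ℕ.+
    loopTime (λ st x → value b (x ∷ st ∷ ρ)) (λ st x → time b (x ∷ st ∷ ρ))
             (value s ρ) (value e ρ)

  output : ∀ {σ τ} → Program σ τ → Val σ → Val τ
  output p x = value p (x ∷ [])

  runningTime : ∀ {σ τ} → Program σ τ → Val σ → ℕ
  runningTime p x = time p (x ∷ [])

------------------------------------------------------------------------
-- Functions given by lists of breakpoints
------------------------------------------------------------------------

-- Functions with a restricted domain are total functions on the carrier;
-- values outside the domain are junk and every property below is relative to
-- the domain.
module Functions {c ℓ₁ ℓ₂ : Level} (K : OrderedField c ℓ₁ ℓ₂) where

  open OrderedField K

  Domain : Set (c ⊔ suc ℓ₂)
  Domain = Carrier → Set ℓ₂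

  NonDecreasingOn : Domain → (Carrier → Carrier) → Set (c ⊔ ℓ₂)
  NonDecreasingOn D f = ∀ {s t} → D s → D t → s ≤ t → f s ≤ f t

  Within : Carrier → Carrier → Carrier → Set (ℓ₁ ⊔ ℓ₂)
  Within δ t s = (t - δ < s) × (s < t + δ)

  ContinuousOn : Domain → (Carrier → Carrier) → Set (c ⊔ ℓ₁ ⊔ ℓ₂)
  ContinuousOn D f = ∀ {t} → D t → ∀ {ε} → 0# < ε →
    Σ[ δ ∈ Carrier ] (0# < δ) × (∀ {s} → D s → Within δ t s → Within ε (f t) (f s))

  LowerSemicontinuousOn : Domain → (Carrier → Carrier) → Set (c ⊔ ℓ₁ ⊔ ℓ₂)
  LowerSemicontinuousOn D f = ∀ {t} → D t → ∀ {y} → y < f t →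
    Σ[ δ ∈ Carrier ] (0# < δ) × (∀ {s} → D s → Within δ t s → y < f s)

  [_⋯_] : Carrier → Carrier → Domain
  [ lo ⋯ hi ] t = (lo ≤ t) × (t ≤ hi)

  -- (t , f t)
  Point : Set c
  Point = Carrier × Carrier

  -- Linear interpolation between consecutive points; slope m after the last.
  interpolate : Carrier → Point → List Point → Carrier → Carrier
  interpolate m (p , y) []             t = y + m * (t - p)
  interpolate m (p , y) ((q , z) ∷ ps) t with t ≤? q
  ... | yes _ = y + (z - y) * (q - p) ⁻¹ * (t - p)
  ... | no  _ = interpolate m (q , z) ps t

  StrictlySorted : List Carrier → Set (c ⊔ ℓ₁ ⊔ ℓ₂)
  StrictlySorted = Linked _<_

  firstTime : List⁺ Point → Carrier
  firstTime (p ∷ ps) = proj₁ p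

  lastTime : List⁺ Point → Carrier
  lastTime (p ∷ ps) = proj₁ (List.foldl (λ _ q → q) p ps)

  -- The domain is (-∞ , lastTime].
  evalArrival : List⁺ Point → Carrier → Carrier
  evalArrival (p ∷ ps) t with t ≤? proj₁ p
  ... | yes _ = proj₂ p
  ... | no  _ = interpolate 0# p ps t

  -- continuous follows from the representation; it is listed because it is
  -- part of the definition of an arrival time function.
  record ArrivalTimeFunction : Set (c ⊔ ℓ₁ ⊔ ℓ₂) where
    field
      breakpoints   : List⁺ Point
      sorted        : StrictlySorted (List.map proj₁ (List⁺.toList breakpoints))
      continuous    : ContinuousOn (_≤ lastTime breakpoints) (evalArrival breakpoints)
      nonDecreasing : NonDecreasingOn (_≤ lastTime breakpoints) (evalArrival breakpoints)
      t≤⟦t⟧         : ∀ {t} → t ≤ lastTime breakpoints → t ≤ evalArrival breakpoints t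

    tMin tMax : Carrier
    tMin = firstTime breakpoints
    tMax = lastTime breakpoints

    ⟦_⟧ : Carrier → Carrier
    ⟦_⟧ = evalArrival breakpoints

    size : ℕ
    size = List⁺.length breakpoints

  evalPL : List⁺ Point → Carrier → Carrier → Carrier
  evalPL (p ∷ ps) finalSlope = interpolate finalSlope p ps

  -- Continuous non-decreasing piecewise linear functions on [0,∞).  The left
  -- end 0 of the domain is always listed, and counted, as a breakpoint (as tMin
  -- and tMax are for arrival time functions), so size is at least 1.
  record NonDecreasingPL : Set (c ⊔ ℓ₁ ⊔ ℓ₂) where
    field
      breakpoints   : List⁺ Point
      finalSlope    : Carrier
      startsAt0     : firstTime breakpoints ≈ 0#
      sorted        : StrictlySorted (List.map proj₁ (List⁺.toList breakpoints))
      continuous    : ContinuousOn (0# ≤_) (evalPL breakpoints finalSlope)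
      nonDecreasing : NonDecreasingOn (0# ≤_) (evalPL breakpoints finalSlope)

    ⟦_⟧ : Carrier → Carrier
    ⟦_⟧ = evalPL breakpoints finalSlope

    size : ℕ
    size = List⁺.length breakpoints

  -- (p , v , w): the value is v at p, and w from p to the next breakpoint
  -- (both exclusive).
  Jump : Set c
  Jump = Carrier × Carrier × Carrier

  -- u is the value before the first jump.
  evalStep : Carrier → List Jump → Carrier → Carrier
  evalStep u []                 t = u
  evalStep u ((p , v , w) ∷ js) t with t ≟ p | t ≤? p
  ... | yes _ | _     = v
  ... | no  _ | yes _ = u
  ... | no  _ | no  _ = evalStep w js t

  -- For x ≤ y, the integral over [x , y]: the sum over all pieces of
  -- value × length.  [x , y] is split at each jump p; the part left of p has
  -- length (y ⊓ p) - (x ⊓ p).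
  integrateStep : Carrier → List Jump → Carrier → Carrier → Carrier
  integrateStep u []                 x y = u * (y - x)
  integrateStep u ((p , v , w) ∷ js) x y =
    u * ((y ⊓ p) - (x ⊓ p)) + integrateStep w js (x ⊔ᴷ p) (y ⊔ᴷ p)

  -- Piecewise constant functions on [lo , hi].  Values at jumps are arbitrary,
  -- a jump may sit at an end of the domain, and a listed jump need not be a
  -- genuine discontinuity.
  record PiecewiseConstant (lo hi : Carrier) : Set (c ⊔ ℓ₁ ⊔ ℓ₂) where
    field
      initial  : Carrier
      jumps    : List Jump
      sorted   : StrictlySorted (List.map proj₁ jumps)
      inDomain : All [ lo ⋯ hi ] (List.map proj₁ jumps)

    ⟦_⟧ : Carrier → Carrier
    ⟦_⟧ = evalStep initial jumps

    ∫ : Carrier → Carrier → Carrier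
    ∫ = integrateStep initial jumps

    size : ℕ
    size = List.length jumps

  IsMinimizer : Domain → (Carrier → Carrier) → Carrier → Set (c ⊔ ℓ₂)
  IsMinimizer D f t = D t × (∀ {s} → D s → f t ≤ f s)

  IsLeastMinimizer : Domain → (Carrier → Carrier) → Carrier → Set (c ⊔ ℓ₂)
  IsLeastMinimizer D f t = IsMinimizer D f t × (∀ {s} → IsMinimizer D f s → t ≤ s)

  open ArrivalTimeFunction public using (tMin; tMax)

  totalCost : (a : ArrivalTimeFunction) →
              PiecewiseConstant (tMin a) (tMax a) →
              NonDecreasingPL →
              PiecewiseConstant (tMin a) (ArrivalTimeFunction.⟦_⟧ a (tMax a)) →
              Carrier → Carrier
  totalCost a c_a c_ot c_wt t₀ =
    c_a.⟦_⟧ t₀ + c_ot.⟦_⟧ (a.⟦_⟧ t₀ - t₀) + c_wt.∫ t₀ (a.⟦_⟧ t₀)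
    where
    module a    = ArrivalTimeFunction a
    module c_a  = PiecewiseConstant c_a
    module c_ot = NonDecreasingPL c_ot
    module c_wt = PiecewiseConstant c_wt

-- The input of the algorithm: the lists representing a, c_a, c_ot and c_wt.
PointsTy JumpsTy InputTy : Ty
PointsTy = list (real ⊗ real)
JumpsTy  = list (real ⊗ real ⊗ real)
InputTy  = PointsTy ⊗ (real ⊗ JumpsTy) ⊗ (PointsTy ⊗ real) ⊗ (real ⊗ JumpsTy)

module _ {c ℓ₁ ℓ₂ : Level} (K : OrderedField c ℓ₁ ℓ₂) where

  open RealRAM K
  open Functions K

  encode : (a : ArrivalTimeFunction) →
           PiecewiseConstant (tMin a) (tMax a) →
           NonDecreasingPL →
           PiecewiseConstant (tMin a) (ArrivalTimeFunction.⟦_⟧ a (tMax a)) →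
           Val InputTy
  encode a c_a c_ot c_wt =
      List⁺.toList a.breakpoints
    , (c_a.initial , c_a.jumps)
    , (List⁺.toList c_ot.breakpoints , c_ot.finalSlope)
    , (c_wt.initial , c_wt.jumps)
    where
    module a    = ArrivalTimeFunction a
    module c_a  = PiecewiseConstant c_a
    module c_ot = NonDecreasingPL c_ot
    module c_wt = PiecewiseConstant c_wt

{-# OPTIONS --safe #-}
-- Along the trajectory t ↦ (t , a t) everything but c_a is continuous and
-- piecewise linear, and only slopes matter for the minimizers.  The waiting cost
-- is W (a t) - W t for an antiderivative W of c_wt.  Merging the linear pieces
-- of a with the jumps of a step function, in the order of a monotone key k, adds
-- the antiderivative of that function at k t to the cost; this is done for the
-- slopes of c_ot with key ± (a t - t), which is monotone on each segment of a,
-- and for c_wt with keys t and a t.  Each step removes a piece or a jump, so a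
-- merge takes linear time, and only the one with c_ot starts anew on each
-- segment of a, whence the term b-c_ot * b-a.  Between the jumps of c_a and the
-- ends of the resulting pieces the total cost is affine, so by lower
-- semicontinuity the least minimizer is one of these points.
module Submission where

-- The language has neither recursion nor unbounded loops: `for-each` only visits a list. A merge,
-- whose number of rounds is the length of neither list, is therefore run for the sum of both
-- lengths, with a step that does nothing once the cells are used up. A potential that falls by one
-- in each round until it is 0 shows that this suffices. Lists are read from the head only, while
-- the waiting time may rise on one segment and fall on the next. The slopes of c_ot are therefore
-- prepared twice, for f and for x ↦ f (- x), so that either direction becomes a forward reading. A
-- cell records its duration and slopes, not its ends, so it can be cut without knowing the absolute
-- cost; the additive constant lost in this way does not move the minimizers. The sweep with c_ot
-- enters each segment with a single cell and leaves at most b-c_ot + 1 cells there; each of the two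
-- sweeps with c_wt adds at most b-c_wt. This keeps the list that is finally scanned within the
-- claimed bound.

open import Algebra.Bundles using (CommutativeRing; RawRing)
import Algebra.Construct.NaturalChoice.Max as Max
import Algebra.Construct.NaturalChoice.Min as Min
open import Data.Empty using (⊥)
open import Data.List.Base as List using (List; []; _∷_; _ʳ++_)
open import Data.List.Membership.Propositional using (_∈_)
open import Data.List.NonEmpty.Base as List⁺ using (List⁺; _∷_)
open import Data.List.Properties using (length-reverse)
open import Data.List.Relation.Unary.All as All using (All; []; _∷_)
open import Data.List.Relation.Unary.Any using (here; there)
open import Data.List.Relation.Unary.Linked using (Linked; []; [-]; _∷_)
open import Data.Maybe.Base as Maybe using (just; nothing)
open import Data.Nat.Base using (ℕ)
import Data.Nat.Base as ℕ
import Data.Nat.Properties as ℕ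
open import Data.Nat.Solver using (module +-*-Solver)
open import Data.Product.Base using (Σ-syntax; _×_; _,_; proj₁; proj₂)
open import Data.Product.Properties using (≡-dec)
open import Data.Sum.Base using (_⊎_; inj₁; inj₂)
open import Data.Unit.Base using (⊤; tt)
import Data.Unit.Polymorphic.Base as Poly
open import Defs
open import Function.Base using (_$_; _∋_)
open import Level using (Level; _⊔_)
open import Relation.Binary.Bundles using (DecTotalOrder)
import Relation.Binary.PropositionalEquality.Core as ≡
open import Relation.Nullary.Decidable.Core using (yes; no; dec⇒maybe)
open import Relation.Nullary.Negation.Core using (¬_; contradiction)

-- A ring solver needs coefficients whose equality is decided by evaluation,
-- which the abstract scalars do not provide; formal differences of natural
-- numbers do.
module DifferenceSolver {c ℓ} (R : CommutativeRing c ℓ) where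

  open CommutativeRing R
  open import Algebra.Properties.AbelianGroup +-abelianGroup
    using (ε⁻¹≈ε; ⁻¹-∙-comm; ⁻¹-anti-homo‿-)
  open import Algebra.Properties.CommutativeSemigroup +-commutativeSemigroup
    using (interchange)
  open import Algebra.Properties.Ring ring using (x[y-z]≈xy-xz; [y-z]x≈yx-zx; -‿distribʳ-*)
  open import Algebra.Properties.Semiring.Mult.TCOptimised semiring
    using (1+×; ×-homo-+; ×1-homo-*) renaming (_×_ to _·_)
  open import Algebra.Solver.Ring.AlmostCommutativeRing
    using (fromCommutativeRing; _-Raw-AlmostCommutative⟶_)
  open import Relation.Binary.Reasoning.Setoid setoid

  private
    -- Common successors cancel until one component is 0, so equal integers get equal pairs and
    -- `≡-dec` finds every coefficient that vanishes.
    reduce : ℕ → ℕ → ℕ × ℕ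
    reduce (ℕ.suc a) (ℕ.suc b) = reduce a b
    reduce a         b         = a , b

    differences : RawRing _ _
    differences = record
      { Carrier = ℕ × ℕ
      ; _≈_     = ≡._≡_
      ; _+_     = λ (a , b) (c , d) → reduce (a ℕ.+ c) (b ℕ.+ d)
      ; _*_     = λ (a , b) (c , d) → reduce (a ℕ.* c ℕ.+ b ℕ.* d) (a ℕ.* d ℕ.+ b ℕ.* c)
      ; -_      = λ (a , b) → b , a
      ; 0#      = 0 , 0
      ; 1#      = 1 , 0
      }

    -- The first clause makes (0 , 0) and (1 , 0) reduce to 0# and 1#.
    ⟦_⟧ : ℕ × ℕ → Carrier
    ⟦ a , ℕ.zero ⟧    = a · 1#
    ⟦ a , b@(ℕ.suc _) ⟧ = a · 1# - b · 1#

    ⟦⟧-difference : ∀ a b → ⟦ a , b ⟧ ≈ a · 1# - b · 1#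
    ⟦⟧-difference a ℕ.zero    = sym (trans (+-congˡ ε⁻¹≈ε) (+-identityʳ _))
    ⟦⟧-difference a (ℕ.suc b) = refl

    -‿interchange : ∀ a b c d → (a + c) - (b + d) ≈ (a - b) + (c - d)
    -‿interchange a b c d = begin
      (a + c) - (b + d)      ≈⟨ +-congˡ (⁻¹-∙-comm b d) ⟨
      (a + c) + (- b + - d)  ≈⟨ interchange a c (- b) (- d) ⟩
      (a - b) + (c - d)      ∎

    ⟦reduce⟧ : ∀ a b → ⟦ reduce a b ⟧ ≈ a · 1# - b · 1#
    ⟦reduce⟧ ℕ.zero    b         = ⟦⟧-difference 0 b
    ⟦reduce⟧ (ℕ.suc a) ℕ.zero    = ⟦⟧-difference (ℕ.suc a) 0
    ⟦reduce⟧ (ℕ.suc a) (ℕ.suc b) = begin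
      ⟦ reduce a b ⟧                     ≈⟨ ⟦reduce⟧ a b ⟩
      a · 1# - b · 1#                    ≈⟨ +-identityˡ _ ⟨
      0# + (a · 1# - b · 1#)             ≈⟨ +-congʳ (-‿inverseʳ 1#) ⟨
      (1# - 1#) + (a · 1# - b · 1#)      ≈⟨ -‿interchange _ _ _ _ ⟨
      (1# + a · 1#) - (1# + b · 1#)
        ≈⟨ +-cong (1+× a 1#) (-‿cong (1+× b 1#)) ⟨
      ℕ.suc a · 1# - ℕ.suc b · 1#        ∎

    +-homo : ∀ x y → ⟦ RawRing._+_ differences x y ⟧ ≈ ⟦ x ⟧ + ⟦ y ⟧
    +-homo (a , b) (c , d) = begin
      ⟦ reduce (a ℕ.+ c) (b ℕ.+ d) ⟧            ≈⟨ ⟦reduce⟧ (a ℕ.+ c) (b ℕ.+ d) ⟩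
      (a ℕ.+ c) · 1# - (b ℕ.+ d) · 1#
        ≈⟨ +-cong (×-homo-+ 1# a c) (-‿cong (×-homo-+ 1# b d)) ⟩
      (a · 1# + c · 1#) - (b · 1# + d · 1#)     ≈⟨ -‿interchange _ _ _ _ ⟩
      (a · 1# - b · 1#) + (c · 1# - d · 1#)
        ≈⟨ +-cong (⟦⟧-difference a b) (⟦⟧-difference c d) ⟨
      ⟦ a , b ⟧ + ⟦ c , d ⟧                     ∎

    ·1-homo-+* : ∀ a b c d →
      (a ℕ.* b ℕ.+ c ℕ.* d) · 1# ≈ (a · 1#) * (b · 1#) + (c · 1#) * (d · 1#)
    ·1-homo-+* a b c d = trans (×-homo-+ 1# (a ℕ.* b) (c ℕ.* d))
                               (+-cong (×1-homo-* a b) (×1-homo-* c d))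

    -‿product : ∀ a b c d → (a * c + b * d) - (a * d + b * c) ≈ (a - b) * (c - d)
    -‿product a b c d = begin
      (a * c + b * d) - (a * d + b * c)    ≈⟨ -‿interchange _ _ _ _ ⟩
      (a * c - a * d) + (b * d - b * c)
        ≈⟨ +-cong (x[y-z]≈xy-xz a c d) (x[y-z]≈xy-xz b d c) ⟨
      a * (c - d) + b * (d - c)            ≈⟨ +-congˡ (*-congˡ (⁻¹-anti-homo‿- c d)) ⟨
      a * (c - d) + b * - (c - d)          ≈⟨ +-congˡ (-‿distribʳ-* b (c - d)) ⟨
      a * (c - d) - b * (c - d)            ≈⟨ [y-z]x≈yx-zx (c - d) a b ⟨
      (a - b) * (c - d)                    ∎

    *-homo : ∀ x y → ⟦ RawRing._*_ differences x y ⟧ ≈ ⟦ x ⟧ * ⟦ y ⟧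
    *-homo (a , b) (c , d) = begin
      ⟦ reduce (a ℕ.* c ℕ.+ b ℕ.* d) (a ℕ.* d ℕ.+ b ℕ.* c) ⟧
        ≈⟨ ⟦reduce⟧ (a ℕ.* c ℕ.+ b ℕ.* d) (a ℕ.* d ℕ.+ b ℕ.* c) ⟩
      (a ℕ.* c ℕ.+ b ℕ.* d) · 1# - (a ℕ.* d ℕ.+ b ℕ.* c) · 1#
        ≈⟨ +-cong (·1-homo-+* a c b d) (-‿cong (·1-homo-+* a d b c)) ⟩
      _                                           ≈⟨ -‿product _ _ _ _ ⟩
      (a · 1# - b · 1#) * (c · 1# - d · 1#)
        ≈⟨ *-cong (⟦⟧-difference a b) (⟦⟧-difference c d) ⟨
      ⟦ a , b ⟧ * ⟦ c , d ⟧                       ∎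

    -‿homo : ∀ x → ⟦ RawRing.-_ differences x ⟧ ≈ - ⟦ x ⟧
    -‿homo (a , b) = begin
      ⟦ b , a ⟧            ≈⟨ ⟦⟧-difference b a ⟩
      b · 1# - a · 1#      ≈⟨ ⁻¹-anti-homo‿- _ _ ⟨
      - (a · 1# - b · 1#)  ≈⟨ -‿cong (⟦⟧-difference a b) ⟨
      - ⟦ a , b ⟧          ∎

    morphism : differences -Raw-AlmostCommutative⟶ fromCommutativeRing R
    morphism = record
      { ⟦_⟧ = ⟦_⟧ ; +-homo = +-homo ; *-homo = *-homo ; -‿homo = -‿homo
      ; 0-homo = refl ; 1-homo = refl }

  open import Algebra.Solver.Ring differences (fromCommutativeRing R) morphism
    (λ x y → Maybe.map (λ x≡y → reflexive (≡.cong ⟦_⟧ x≡y))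
                       (dec⇒maybe (≡-dec ℕ._≟_ ℕ._≟_ x y)))
    public using (Polynomial; con; solve; _:=_; _:+_; _:*_; _:-_; :-_)

  𝟎 𝟏 : ∀ {n} → Polynomial n
  𝟎 = con (0 , 0)
  𝟏 = con (1 , 0)

-- Ordered field arithmetic

module OrderedFieldProperties {c ℓ₁ ℓ₂ : Level} (K : OrderedField c ℓ₁ ℓ₂) where

  open OrderedField K public
  open CommutativeRing commutativeRing public
    using ( refl; sym; trans; setoid; +-cong; +-congˡ; +-congʳ
          ; +-assoc; *-congˡ; *-congʳ; -‿cong; +-identityˡ; +-identityʳ; +-comm
          ; *-identityˡ; *-identityʳ; zeroʳ; -‿inverseʳ)
  open DecTotalOrder decTotalOrder public
    using (antisym; ≤-respˡ-≈; ≤-respʳ-≈)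
    renaming (refl to ≤-refl; reflexive to ≤-reflexive; trans to ≤-trans)
  open import Relation.Binary.Properties.DecTotalOrder decTotalOrder public
    using (<-trans; <-respˡ-≈; <-respʳ-≈; <⇒≱; ≰⇒>; ≰⇒≥)
  open DifferenceSolver commutativeRing public

  ≤-<-trans : ∀ {x y z} → x ≤ y → y < z → x < z
  ≤-<-trans x≤y (y≤z , y≉z) =
    ≤-trans x≤y y≤z , λ x≈z → y≉z (antisym y≤z (≤-respˡ-≈ x≈z x≤y))

  <-≤-trans : ∀ {x y z} → x < y → y ≤ z → x < z
  <-≤-trans (x≤y , x≉y) y≤z =
    ≤-trans x≤y y≤z , λ x≈z → x≉y (antisym x≤y (≤-respʳ-≈ (sym x≈z) y≤z))

  ≤-or-< : ∀ x y → x ≤ y ⊎ y < x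
  ≤-or-< x y with x ≤? y
  ... | yes x≤y = inj₁ x≤y
  ... | no  x≰y = inj₂ (≰⇒> x≰y)

  x≤x+d : ∀ {x d} → 0# ≤ d → x ≤ x + d
  x≤x+d {x} {d} 0≤d =
    ≤-respˡ-≈ (+-identityˡ x) (≤-respʳ-≈ (+-comm d x) (+-monoˡ-≤ x 0≤d))

  ≤-from-difference : ∀ {x y d} → 0# ≤ d → y ≈ x + d → x ≤ y
  ≤-from-difference 0≤d y≈x+d = ≤-respʳ-≈ (sym y≈x+d) (x≤x+d 0≤d)

  x≤y⇒0≤y-x : ∀ {x y} → x ≤ y → 0# ≤ y - x
  x≤y⇒0≤y-x {x} x≤y = ≤-respˡ-≈ (-‿inverseʳ x) (+-monoˡ-≤ (- x) x≤y)

  +-mono-≤ : ∀ {x y u v} → x ≤ y → u ≤ v → x + u ≤ y + v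
  +-mono-≤ {x} {y} {u} {v} x≤y u≤v = ≤-trans (+-monoˡ-≤ u x≤y)
    (≤-respˡ-≈ (+-comm u y) (≤-respʳ-≈ (+-comm v y) (+-monoˡ-≤ y u≤v)))

  +-cancelʳ-≤ : ∀ {x y} z → x + z ≤ y + z → x ≤ y
  +-cancelʳ-≤ {x} {y} z p = ≤-respˡ-≈ (e x) (≤-respʳ-≈ (e y) (+-monoˡ-≤ (- z) p))
    where
    e : ∀ x → x + z + - z ≈ x
    e x = solve 2 (λ x z → x :+ z :+ (:- z) := x) refl x z

  +-monoˡ-< : ∀ {x y} z → x < y → x + z < y + z
  +-monoˡ-< z (x≤y , x≉y) =
    +-monoˡ-≤ z x≤y , λ e → x≉y (antisym x≤y (+-cancelʳ-≤ z (≤-reflexive (sym e))))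

  +-monoʳ-≤ : ∀ {x y} z → x ≤ y → z + x ≤ z + y
  +-monoʳ-≤ z = +-mono-≤ ≤-refl

  x<y⇒0<y-x : ∀ {x y} → x < y → 0# < y - x
  x<y⇒0<y-x {x} x<y = <-respˡ-≈ (-‿inverseʳ x) (+-monoˡ-< (- x) x<y)

  <-from-difference : ∀ {x y d} → 0# < d → y ≈ x + d → x < y
  <-from-difference {x} {d = d} 0<d y≈x+d =
    <-respˡ-≈ (+-identityˡ x)
      (<-respʳ-≈ (sym (trans y≈x+d (+-comm x d))) (+-monoˡ-< x 0<d))

  x≤0⇒0≤-x : ∀ {x} → x ≤ 0# → 0# ≤ - x
  x≤0⇒0≤-x {x} x≤0 = ≤-respʳ-≈ (+-identityˡ (- x)) (x≤y⇒0≤y-x x≤0)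

  *-zero-product : ∀ {x y} → ¬ x ≈ 0# → x * y ≈ 0# → y ≈ 0#
  *-zero-product {x} {y} x≉0 xy≈0 = begin
    y                ≈⟨ *-identityˡ y ⟨
    1# * y           ≈⟨ *-congʳ (*-inverseʳ x x≉0) ⟨
    x * x ⁻¹ * y     ≈⟨ solve 3 (λ x i y → x :* i :* y := i :* (x :* y)) refl x (x ⁻¹) y ⟩
    x ⁻¹ * (x * y)   ≈⟨ *-congˡ xy≈0 ⟩
    x ⁻¹ * 0#        ≈⟨ zeroʳ (x ⁻¹) ⟩
    0#               ∎
    where open import Relation.Binary.Reasoning.Setoid setoid

  *-pos : ∀ {x y} → 0# < x → 0# < y → 0# < x * y
  *-pos (0≤x , 0≉x) (0≤y , 0≉y) = *-nonneg 0≤x 0≤y ,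
    λ 0≈xy → 0≉y (sym (*-zero-product (λ x≈0 → 0≉x (sym x≈0)) (sym 0≈xy)))

  *-monoˡ-≤ : ∀ {x y z} → 0# ≤ z → x ≤ y → z * x ≤ z * y
  *-monoˡ-≤ {x} {y} {z} 0≤z x≤y = ≤-from-difference (*-nonneg 0≤z (x≤y⇒0≤y-x x≤y))
    (solve 3 (λ x y z → z :* y := z :* x :+ z :* (y :- x)) refl x y z)

  -- If `1#` were negative, it would still be nonnegative as the square of `- 1#`.
  0<1 : 0# < 1#
  0<1 with ≤-or-< 0# 1#
  ... | inj₁ 0≤1 = 0≤1 , 0≉1
  ... | inj₂ (1≤0 , _) = contradiction (antisym 0≤1 1≤0) 0≉1
    where
    0≤1 : 0# ≤ 1#
    0≤1 = ≤-respʳ-≈ (solve 0 (:- 𝟏 :* (:- 𝟏) := 𝟏) refl)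
            (*-nonneg (x≤0⇒0≤-x 1≤0) (x≤0⇒0≤-x 1≤0))

  -- With a nonpositive inverse, the product of `x` and `- (x ⁻¹)` would be nonnegative, but it is
  -- `- 1#`.
  ⁻¹-pos : ∀ {x} → 0# < x → 0# < x ⁻¹
  ⁻¹-pos {x} (0≤x , 0≉x) with ≤-or-< (x ⁻¹) 0#
  ... | inj₂ 0<x⁻¹ = 0<x⁻¹
  ... | inj₁ x⁻¹≤0 = contradiction
    (≤-respʳ-≈ (trans (solve 2 (λ x i → x :* (:- i) := :- (x :* i)) refl x (x ⁻¹))
                      (-‿cong (*-inverseʳ x (λ x≈0 → 0≉x (sym x≈0)))))
               (*-nonneg 0≤x (x≤0⇒0≤-x x⁻¹≤0)))
    (<⇒≱ (<-from-difference 0<1 (solve 0 (𝟎 := :- 𝟏 :+ 𝟏) refl)))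

  *-cancelˡ-≤ : ∀ {x y z} → 0# < z → z * x ≤ z * y → x ≤ y
  *-cancelˡ-≤ {x} {y} {z} 0<z zx≤zy =
    ≤-respˡ-≈ (cancel x) (≤-respʳ-≈ (cancel y) (*-monoˡ-≤ (proj₁ (⁻¹-pos 0<z)) zx≤zy))
    where
    cancel : ∀ x → z ⁻¹ * (z * x) ≈ x
    cancel x = trans (solve 3 (λ z i x → i :* (z :* x) := z :* i :* x) refl z (z ⁻¹) x)
      (trans (*-congʳ (*-inverseʳ z (λ z≈0 → proj₂ 0<z (sym z≈0)))) (*-identityˡ x))

  abstract
    -- The midpoint. Density of the order provides the test points beside a jump at which lower
    -- semicontinuity is evaluated.
    between : ∀ {x y} → x < y → Σ[ z ∈ Carrier ] x < z × z < y
    between {x} {y} x<y = x + h * (y - x) ,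
      <-from-difference half-gap refl ,
      <-from-difference half-gap (begin
        y                                     ≈⟨ solve 2 (λ x y → y := x :+ 𝟏 :* (y :- x)) refl x y ⟩
        x + 1# * (y - x)                      ≈⟨ +-congˡ (*-congʳ (*-inverseʳ _ 2≉0)) ⟨
        x + (1# + 1#) * h * (y - x)
          ≈⟨ solve 3 (λ x y h → x :+ (𝟏 :+ 𝟏) :* h :* (y :- x)
                                := x :+ h :* (y :- x) :+ h :* (y :- x)) refl x y h ⟩
        x + h * (y - x) + h * (y - x)         ∎)
      where
      open import Relation.Binary.Reasoning.Setoid setoid
      0<2 : 0# < 1# + 1#
      0<2 = <-≤-trans 0<1 (x≤x+d (proj₁ 0<1))
      2≉0 : ¬ 1# + 1# ≈ 0#
      2≉0 2≈0 = proj₂ 0<2 (sym 2≈0)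
      h : Carrier
      h = (1# + 1#) ⁻¹
      half-gap : 0# < h * (y - x)
      half-gap = *-pos (⁻¹-pos 0<2) (x<y⇒0<y-x x<y)

-- The program

private
  variable
    Γ : Ctx
    σ τ υ : Ty

v₀ : Term (σ ∷ Γ) σ
v₀ = var (here ≡.refl)

v₁ : Term (σ ∷ τ ∷ Γ) τ
v₁ = var (there (here ≡.refl))

v₂ : Term (σ ∷ τ ∷ υ ∷ Γ) υ
v₂ = var (there (there (here ≡.refl)))

v₃ : ∀ {a} → Term (σ ∷ τ ∷ υ ∷ a ∷ Γ) a
v₃ = var (there (there (there (here ≡.refl))))

v₄ : ∀ {a b} → Term (σ ∷ τ ∷ υ ∷ a ∷ b ∷ Γ) b
v₄ = var (there (there (there (there (here ≡.refl)))))

reverseᵀ : Program (list τ) (list τ)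
reverseᵀ = for-each v₀ nil (cons v₀ v₁)

-- Enough rounds for a step that removes an element of one of the two lists.
exhaust : Term (τ ∷ []) (list σ) → Term (τ ∷ []) (list υ) → Program τ τ → Program τ τ
exhaust xs ys step = for-each xs (for-each ys v₀ (call step v₁)) (call step v₁)

-- A linear piece of the trajectory t ↦ (t , a t , g t): its duration, the
-- slope of a and the slope of the cost g.
CellTy : Ty
CellTy = real ⊗ real ⊗ real

-- The value before the first jump, and the jumps.
StepTy : Ty
StepTy = real ⊗ JumpsTy

duration arrivalSlope costSlope : Term Γ CellTy → Term Γ real
duration     c = fst c
arrivalSlope c = fst (snd c)
costSlope    c = snd (snd c)

-- Current key, remaining step function, remaining cells, finished cells (most
-- recent first).
SweepTy : Ty
SweepTy = real ⊗ StepTy ⊗ list CellTy ⊗ list CellTy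

-- `key` computes the slope of the key on a cell, `weight` this slope times the factor with which
-- the antiderivative enters the cost. By the chain rule, a cell crossed at step value u gains the
-- cost slope u times `weight`.
module SweepProgram (key weight : Program CellTy real) where

  emit : Term Γ SweepTy → Term Γ CellTy → Term Γ real → Term Γ (list CellTy)
  emit st c ℓ =
    cons (pair ℓ (pair (arrivalSlope c)
                       (add (costSlope c) (mul (fst (fst (snd st))) (call weight c)))))
         (snd (snd (snd st)))

  finishCell : Term Γ SweepTy → Term Γ CellTy → Term Γ (list CellTy) → Term Γ SweepTy
  finishCell st c cs =
    pair (add (fst st) (mul (call key c) (duration c)))
         (pair (fst (snd st)) (pair cs (emit st c (duration c))))

  -- The key is affine on the cell, so this solves for the moment at which it reaches the jump. It
  -- is used only if the jump lies above the current key and not above the key at the end of the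
  -- cell, which makes the divisor positive.
  timeToJump : Term Γ SweepTy → Term Γ CellTy → Term Γ (real ⊗ real ⊗ real) → Term Γ real
  timeToJump st c j = div (sub (fst j) (fst st)) (call key c)

  cutCell : Term Γ SweepTy → Term Γ CellTy → Term Γ (list CellTy) →
            Term Γ (real ⊗ real ⊗ real) → Term Γ JumpsTy → Term Γ SweepTy
  cutCell st c cs j js =
    pair (fst j)
         (pair (pair (snd (snd j)) js)
               (pair (cons (pair (sub (duration c) (timeToJump st c j)) (snd c)) cs)
                     (emit st c (timeToJump st c j))))

  sweepStep : Program SweepTy SweepTy
  sweepStep =
    case-list (fst (snd (snd v₀))) v₀
      (case-list (snd (fst (snd v₂))) (finishCell v₂ v₀ v₁)
        -- The key may start beyond the first jumps; those are dropped without touching a cell.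
        (if fst v₀ ≤ fst v₄
         then pair (fst v₄) (pair (pair (snd (snd v₀)) v₁) (snd (snd v₄)))
         -- A jump that the key meets exactly at the end of the cell also cuts it and leaves a cell
         -- of duration 0.
         else (if fst v₀ ≤ add (fst v₄) (mul (call key v₂) (duration v₂))
               then cutCell v₄ v₂ v₃ v₀ v₁
               else finishCell v₄ v₂ v₃)))

  sweep : Program SweepTy (list CellTy)
  sweep = snd (snd (snd
    (exhaust (snd (fst (snd v₀))) (fst (snd (snd v₀))) sweepStep)))

open SweepProgram using (sweepStep; sweep)

-- The slopes of the keys t, a t, a t - t and t - a t.
clockKey clockWeight arrivalKey risingKey fallingKey : Program CellTy real
clockKey    = one
clockWeight = sub zero one
arrivalKey  = arrivalSlope v₀
risingKey   = sub (arrivalSlope v₀) one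
fallingKey  = sub one (arrivalSlope v₀)

-- From a piecewise linear function f, the step functions that are the slopes
-- of f and of x ↦ f (- x).  Loop state: last point, slope before it, jumps of
-- the first (reversed) and of the second step function.
SlopesTy : Ty
SlopesTy = ((real ⊗ real) ⊗ real) ⊗ JumpsTy ⊗ JumpsTy

neg : Term Γ real → Term Γ real
neg = sub zero

-- Reflection exchanges the two sides of a point, so right of the mirrored point the slope is the
-- negated one from before the point. It also reverses the order: prepending yields the second list
-- sorted and the first one backwards.
nextSlope : Program (SlopesTy ⊗ real) (real ⊗ JumpsTy ⊗ JumpsTy)
nextSlope = pair (snd v₀)
  (pair (cons (pair (fst pt) (pair (snd v₀) (snd v₀))) (fst (snd (fst v₀))))
        (cons (pair (neg (fst pt)) (pair m′ m′)) (snd (snd (fst v₀)))))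
  where
  pt : Term ((SlopesTy ⊗ real) ∷ []) (real ⊗ real)
  pt = fst (fst (fst v₀))
  m′ : Term ((SlopesTy ⊗ real) ∷ []) real
  m′ = neg (snd (fst (fst v₀)))

slopeBetween : Term Γ (real ⊗ real) → Term Γ (real ⊗ real) → Term Γ real
slopeBetween p q = div (sub (snd q) (snd p)) (sub (fst q) (fst p))

slopesStep : Program ((real ⊗ real) ⊗ SlopesTy) SlopesTy
slopesStep =
  let-in (call nextSlope (pair (snd v₀) (slopeBetween (fst (fst (snd v₀))) (fst v₀))))
    (pair (pair (fst v₁) (fst v₀)) (snd v₀))

slopes : Program (PointsTy ⊗ real) (StepTy ⊗ StepTy)
slopes =
  case-list (fst v₀) (pair (pair zero nil) (pair zero nil))
    -- Slope 0 is a placeholder left of the first point, which lies at the left end of the domain.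
    (let-in (for-each v₁ (pair (pair v₀ zero) (pair nil nil)) (call slopesStep (pair v₀ v₁)))
      (let-in (call nextSlope (pair v₀ (snd v₃)))
        (pair (pair zero (call reverseᵀ (fst (snd v₀))))
              (pair (neg (fst v₀)) (snd (snd v₀))))))

-- Next breakpoint of a; last breakpoint and finished cells (most recent first);
-- the slopes of c_ot.
SegmentTy : Ty
SegmentTy = (real ⊗ real) ⊗ ((real ⊗ real) ⊗ list CellTy) ⊗ (StepTy ⊗ StepTy)

segmentStep : Program SegmentTy ((real ⊗ real) ⊗ list CellTy)
segmentStep =
  let-in (slopeBetween (fst (fst (snd v₀))) (fst v₀))
    (pair (fst v₁)
      -- The whole segment as one cell with cost slope 0: c_ot is the first contribution to the
      -- cost.
      (let-in (cons (pair (sub (fst (fst v₁)) (fst (fst (fst (snd v₁))))) (pair v₀ zero)) nil)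
        -- The waiting time has the slope of a minus 1. If this is negative, the negated waiting
        -- time is the key and the reflected slopes of c_ot are read.
        (if one ≤ v₁
         then call (sweep risingKey risingKey)
                (pair (sub (snd (fst (fst (snd v₂)))) (fst (fst (fst (snd v₂)))))
                      (pair (fst (snd (snd v₂))) (pair v₀ (snd (fst (snd v₂))))))
         else call (sweep fallingKey fallingKey)
                (pair (sub (fst (fst (fst (snd v₂)))) (snd (fst (fst (snd v₂)))))
                      (pair (snd (snd (snd v₂))) (pair v₀ (snd (fst (snd v₂)))))))))

overtimePieces : Program (PointsTy ⊗ (StepTy ⊗ StepTy)) (list CellTy)
overtimePieces =
  case-list (fst v₀) nil
    (snd (for-each v₁ (pair v₀ nil) (call segmentStep (pair v₀ (pair v₁ (snd v₄))))))

-- Current time and cost, remaining step function, remaining cells, and the best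
-- candidate (its time and value).
ScanTy : Ty
ScanTy = (real ⊗ real) ⊗ StepTy ⊗ list CellTy ⊗ (real ⊗ real)

-- On a tie the first argument stays. The scan passes the earlier candidate there, which makes the
-- result the least minimizer.
better : Program ((real ⊗ real) ⊗ (real ⊗ real)) (real ⊗ real)
better = if snd (fst v₀) ≤ snd (snd v₀) then fst v₀ else snd v₀

-- The end of a cell of duration 0 must not be visited: the value just right of
-- a jump may lie below the value at the jump there.
unlessEmpty : Program (real ⊗ (real ⊗ real) ⊗ (real ⊗ real)) (real ⊗ real)
unlessEmpty = if fst v₀ ≤ zero then fst (snd v₀) else call better (snd v₀)

costAfter : Term Γ ScanTy → Term Γ CellTy → Term Γ real → Term Γ real
costAfter st c ℓ = add (snd (fst st)) (mul (costSlope c) ℓ)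

scanCell : Term Γ ScanTy → Term Γ CellTy → Term Γ (list CellTy) → Term Γ ScanTy
scanCell st c cs =
  pair (pair t′ g′) (pair (fst (snd st)) (pair cs
    (call unlessEmpty (pair (duration c) (pair (snd (snd (snd st)))
                                               (pair t′ (add (fst (fst (snd st))) g′)))))))
  where
  t′ = add (fst (fst st)) (duration c)
  g′ = costAfter st c (duration c)

scanJump : Term Γ ScanTy → Term Γ CellTy → Term Γ (list CellTy) →
           Term Γ (real ⊗ real ⊗ real) → Term Γ JumpsTy → Term Γ ScanTy
scanJump st c cs j js =
  pair (pair (fst j) g′)
    (pair (pair (snd (snd j)) js)
      (pair (cons (pair (sub (duration c) ℓ) (snd c)) cs)
        (call better (pair (snd (snd (snd st))) (pair (fst j) (add (fst (snd j)) g′))))))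
  where
  ℓ = sub (fst j) (fst (fst st))
  g′ = costAfter st c ℓ

scanStep : Program ScanTy ScanTy
scanStep =
  case-list (fst (snd (snd v₀))) v₀
    (case-list (snd (fst (snd v₂))) (scanCell v₂ v₀ v₁)
      -- A jump at the very end of the cell must go this way: the candidate there needs the value at
      -- the jump, not the one before it.
      (if fst v₀ ≤ add (fst (fst v₄)) (duration v₂)
       then scanJump v₄ v₂ v₃ v₀ v₁
       else scanCell v₄ v₂ v₃))

scan : Program ScanTy real
scan = fst (snd (snd (snd
  (exhaust (snd (fst (snd v₀))) (fst (snd (snd v₀))) scanStep))))

-- A jump of c_a at tMin contributes only its value there.
scanInit : Program (real ⊗ StepTy ⊗ list CellTy) ScanTy
scanInit =
  case-list (snd (fst (snd v₀))) (noJump v₀)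
    (if fst v₀ ≤ fst v₂
     then pair (pair (fst v₂) zero)
            (pair (pair (snd (snd v₀)) v₁)
              (pair (snd (snd v₂)) (pair (fst v₂) (fst (snd v₀)))))
     else noJump v₂)
  where
  noJump : Term Γ (real ⊗ StepTy ⊗ list CellTy) → Term Γ ScanTy
  noJump st = pair (pair (fst st) zero)
    (pair (fst (snd st)) (pair (snd (snd st)) (pair (fst st) (fst (fst (snd st))))))

-- Start of the key, step function, reversed cells.
addStep : (key weight : Program CellTy real) →
          Program (real ⊗ StepTy ⊗ list CellTy) (list CellTy)
addStep key weight =
  call (sweep key weight)
    (pair (fst v₀) (pair (fst (snd v₀)) (pair (call reverseᵀ (snd (snd v₀))) nil)))

startPoint : Program PointsTy (real ⊗ real)
startPoint = case-list v₀ (pair zero zero) v₀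

cells : Program InputTy (list CellTy)
cells =
  let-in (call overtimePieces (pair (fst v₀) (call slopes (fst (snd (snd v₀))))))
    (let-in (call (addStep clockKey clockWeight)
               (pair (fst (call startPoint (fst v₁))) (pair (snd (snd (snd v₁))) v₀)))
      (call (addStep arrivalKey arrivalKey)
        (pair (snd (call startPoint (fst v₂))) (pair (snd (snd (snd v₂))) v₀))))

scanInput : Program InputTy (real ⊗ StepTy ⊗ list CellTy)
scanInput = pair (fst (call startPoint (fst v₀)))
                 (pair (fst (snd v₀)) (call reverseᵀ (call cells v₀)))

leastMinimizer : Program InputTy real
leastMinimizer = call scan (call scanInit (call scanInput v₀))

-- Running time

LoopFree : Term Γ τ → Set
LoopFree (var x)                    = ⊤
LoopFree (let-in e f)               = LoopFree e × LoopFree f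
LoopFree (call p e)                 = LoopFree p × LoopFree e
LoopFree zero                       = ⊤
LoopFree one                        = ⊤
LoopFree (add e f)                  = LoopFree e × LoopFree f
LoopFree (sub e f)                  = LoopFree e × LoopFree f
LoopFree (mul e f)                  = LoopFree e × LoopFree f
LoopFree (div e f)                  = LoopFree e × LoopFree f
LoopFree (if e ≤ f then g else h)   = (LoopFree e × LoopFree f) × LoopFree g × LoopFree h
LoopFree (pair e f)                 = LoopFree e × LoopFree f
LoopFree (fst e)                    = LoopFree e
LoopFree (snd e)                    = LoopFree e
LoopFree nil                        = ⊤
LoopFree (cons e f)                 = LoopFree e × LoopFree f
LoopFree (case-list e f g)          = LoopFree e × LoopFree f × LoopFree g
LoopFree (for-each e s b)           = ⊥

-- Both branches of a case distinction are counted, which gives a bound independent of the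
-- environment. The value for loops is a default, excluded by `LoopFree`.
timeBound : Term Γ τ → ℕ
timeBound (var x)                    = 1
timeBound (let-in e f)               = 1 ℕ.+ timeBound e ℕ.+ timeBound f
timeBound (call p e)                 = 1 ℕ.+ timeBound e ℕ.+ timeBound p
timeBound zero                       = 1
timeBound one                        = 1
timeBound (add e f)                  = 1 ℕ.+ timeBound e ℕ.+ timeBound f
timeBound (sub e f)                  = 1 ℕ.+ timeBound e ℕ.+ timeBound f
timeBound (mul e f)                  = 1 ℕ.+ timeBound e ℕ.+ timeBound f
timeBound (div e f)                  = 1 ℕ.+ timeBound e ℕ.+ timeBound f
timeBound (if e ≤ f then g else h)   =
  1 ℕ.+ timeBound e ℕ.+ timeBound f ℕ.+ (timeBound g ℕ.+ timeBound h)
timeBound (pair e f)                 = 1 ℕ.+ timeBound e ℕ.+ timeBound f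
timeBound (fst e)                    = 1 ℕ.+ timeBound e
timeBound (snd e)                    = 1 ℕ.+ timeBound e
timeBound nil                        = 1
timeBound (cons e f)                 = 1 ℕ.+ timeBound e ℕ.+ timeBound f
timeBound (case-list e f g)          = 1 ℕ.+ timeBound e ℕ.+ (timeBound f ℕ.+ timeBound g)
timeBound (for-each e s b)           = 0

module Execution {c ℓ₁ ℓ₂ : Level} (K : OrderedField c ℓ₁ ℓ₂) where

  open RealRAM K
  private
    module K = OrderedField K

  time≤timeBound : (t : Term Γ τ) → LoopFree t → ∀ ρ → time t ρ ℕ.≤ timeBound t
  time≤timeBound (var x) _ ρ = ℕ.≤-refl
  time≤timeBound (let-in e f) (le , lf) ρ =
    ℕ.s≤s (ℕ.+-mono-≤ (time≤timeBound e le ρ) (time≤timeBound f lf _))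
  time≤timeBound (call p e) (lp , le) ρ =
    ℕ.s≤s (ℕ.+-mono-≤ (time≤timeBound e le ρ) (time≤timeBound p lp _))
  time≤timeBound zero _ ρ = ℕ.≤-refl
  time≤timeBound one _ ρ = ℕ.≤-refl
  time≤timeBound (add e f) (le , lf) ρ =
    ℕ.s≤s (ℕ.+-mono-≤ (time≤timeBound e le ρ) (time≤timeBound f lf ρ))
  time≤timeBound (sub e f) (le , lf) ρ =
    ℕ.s≤s (ℕ.+-mono-≤ (time≤timeBound e le ρ) (time≤timeBound f lf ρ))
  time≤timeBound (mul e f) (le , lf) ρ =
    ℕ.s≤s (ℕ.+-mono-≤ (time≤timeBound e le ρ) (time≤timeBound f lf ρ))
  time≤timeBound (div e f) (le , lf) ρ =
    ℕ.s≤s (ℕ.+-mono-≤ (time≤timeBound e le ρ) (time≤timeBound f lf ρ))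
  time≤timeBound (if e ≤ f then g else h) ((le , lf) , lg , lh) ρ
    with value e ρ K.≤? value f ρ
  ... | yes _ = ℕ.s≤s (ℕ.+-mono-≤ (ℕ.+-mono-≤ (time≤timeBound e le ρ) (time≤timeBound f lf ρ))
                        (ℕ.≤-trans (time≤timeBound g lg ρ) (ℕ.m≤m+n _ _)))
  ... | no  _ = ℕ.s≤s (ℕ.+-mono-≤ (ℕ.+-mono-≤ (time≤timeBound e le ρ) (time≤timeBound f lf ρ))
                        (ℕ.≤-trans (time≤timeBound h lh ρ) (ℕ.m≤n+m _ _)))
  time≤timeBound (pair e f) (le , lf) ρ =
    ℕ.s≤s (ℕ.+-mono-≤ (time≤timeBound e le ρ) (time≤timeBound f lf ρ))
  time≤timeBound (fst e) le ρ = ℕ.s≤s (time≤timeBound e le ρ)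
  time≤timeBound (snd e) le ρ = ℕ.s≤s (time≤timeBound e le ρ)
  time≤timeBound nil _ ρ = ℕ.≤-refl
  time≤timeBound (cons e f) (le , lf) ρ =
    ℕ.s≤s (ℕ.+-mono-≤ (time≤timeBound e le ρ) (time≤timeBound f lf ρ))
  time≤timeBound (case-list e f g) (le , lf , lg) ρ with value e ρ
  ... | []     = ℕ.s≤s (ℕ.+-mono-≤ (time≤timeBound e le ρ)
                         (ℕ.≤-trans (time≤timeBound f lf ρ) (ℕ.m≤m+n _ _)))
  ... | x ∷ xs = ℕ.s≤s (ℕ.+-mono-≤ (time≤timeBound e le ρ)
                         (ℕ.≤-trans (time≤timeBound g lg _) (ℕ.m≤n+m _ _)))

  loopTime≤ : ∀ {S X : Set c} (step : S → X → S) (cost : S → X → ℕ) {k} →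
              (∀ s x → cost s x ℕ.≤ k) →
              ∀ s xs → loopTime step cost s xs ℕ.≤ List.length xs ℕ.* ℕ.suc k
  loopTime≤ step cost cost≤k s []       = ℕ.z≤n
  loopTime≤ step cost cost≤k s (x ∷ xs) =
    ℕ.s≤s (ℕ.+-mono-≤ (cost≤k s x) (loopTime≤ step cost cost≤k (step s x) xs))

  for-each-time : (e : Term Γ (list σ)) (s : Term Γ τ) (b : Term (σ ∷ τ ∷ Γ) τ) →
    ∀ ρ {k} → (∀ st x → time b (x ∷ st ∷ ρ) ℕ.≤ k) →
    time (for-each e s b) ρ ℕ.≤
      1 ℕ.+ time e ρ ℕ.+ time s ρ ℕ.+ List.length (value e ρ) ℕ.* ℕ.suc k
  for-each-time e s b ρ b≤k =
    ℕ.+-monoʳ-≤ (1 ℕ.+ time e ρ ℕ.+ time s ρ)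
      (loopTime≤ _ _ b≤k (value s ρ) (value e ρ))

  -- The slack is `a * n + b`. A fixed cost plus a cost per round thus becomes a multiple of the
  -- size plus one, a form that survives empty lists.
  absorb : ∀ a b n → a ℕ.+ n ℕ.* b ℕ.≤ (a ℕ.+ b) ℕ.* ℕ.suc n
  absorb a b n = ℕ.≤-trans (ℕ.m≤m+n _ (a ℕ.* n ℕ.+ b)) (ℕ.≤-reflexive
    (solve 3 (λ a b n → a :+ n :* b :+ (a :* n :+ b) := (a :+ b) :* (con 1 :+ n)) ≡.refl a b n))
    where open +-*-Solver using (solve; _:=_; _:+_; _:*_; con)

  reverseᵀ-time : (xs : Val (list τ)) →
    time (reverseᵀ {τ})  (xs ∷ []) ℕ.≤ 7 ℕ.* ℕ.suc (List.length xs)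
  reverseᵀ-time {τ} xs = ℕ.≤-trans
    (for-each-time {σ = τ} {τ = list τ} v₀ nil (cons v₀ v₁) (xs ∷ []) {3} λ _ _ → ℕ.≤-refl)
    -- 3 for the loop and its two arguments; 4 per element, of which 3 for the body and 1 for the
    -- iteration.
    (absorb 3 4 (List.length xs))

  module _ (xs : Term (τ ∷ []) (list σ)) (ys : Term (τ ∷ []) (list υ)) (step : Program τ τ)
           (xs-loopFree : LoopFree xs) (ys-loopFree : LoopFree ys)
           (step-loopFree : LoopFree step) where

    exhaustFactor : ℕ
    exhaustFactor = (timeBound xs ℕ.+ timeBound ys ℕ.+ 3) ℕ.+ (3 ℕ.+ timeBound step)

    -- The lengths add up instead of multiplying, since the inner loop computes the initial state of
    -- the outer one and is not part of its body.
    exhaust-time : ∀ st → time (exhaust xs ys step) (st ∷ []) ℕ.≤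
      exhaustFactor ℕ.* ℕ.suc (List.length (value xs (st ∷ [])) ℕ.+ List.length (value ys (st ∷ [])))
    exhaust-time st = ℕ.≤-trans
      (for-each-time xs inner (call step v₁) ρ (step-time {σ}))
      (ℕ.≤-trans
        (ℕ.+-monoˡ-≤ (m ℕ.* b) (ℕ.s≤s (ℕ.+-mono-≤ (time≤timeBound xs xs-loopFree ρ)
          (ℕ.≤-trans (for-each-time ys v₀ (call step v₁) ρ (step-time {υ}))
            (ℕ.+-monoˡ-≤ (n ℕ.* b)
              (ℕ.s≤s (ℕ.+-monoˡ-≤ 1 (time≤timeBound ys ys-loopFree ρ))))))))
        (ℕ.≤-trans (ℕ.≤-reflexive
          (solve 5 (λ x y m n b → con 1 :+ (x :+ (con 1 :+ (y :+ con 1) :+ n :* b)) :+ m :* b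
                                  := (x :+ y :+ con 3) :+ (m :+ n) :* b)
            ≡.refl (timeBound xs) (timeBound ys) m n b))
          (absorb (timeBound xs ℕ.+ timeBound ys ℕ.+ 3) b (m ℕ.+ n))))
      where
      open +-*-Solver using (solve; _:=_; _:+_; _:*_; con)
      b : ℕ
      b = 3 ℕ.+ timeBound step
      ρ : Env (τ ∷ [])
      ρ = st ∷ []
      m n : ℕ
      m = List.length (value xs ρ)
      n = List.length (value ys ρ)
      inner : Term (τ ∷ []) τ
      inner = for-each ys v₀ (call step v₁)
      step-time : ∀ {σ} (st′ : Val τ) (x : Val σ) →
        time {Γ = σ ∷ τ ∷ τ ∷ []} (call step v₁) (x ∷ st′ ∷ ρ) ℕ.≤ 2 ℕ.+ timeBound step
      step-time st′ x = ℕ.+-monoʳ-≤ 2 (time≤timeBound step step-loopFree (st′ ∷ []))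

  module _ (step : Program τ τ) {p} (P : Val τ → Set p) (μ : Val τ → ℕ)
           (preserve : ∀ s → P s → P (value step (s ∷ [])) ×
                                   μ (value step (s ∷ [])) ℕ.≤ ℕ.pred (μ s)) where

    -- `ℕ.pred` lets the potential rest at 0, so surplus rounds do no harm. The elements of `xs`
    -- merely count the rounds.
    loop-preserve : ∀ {X : Set c} (xs : List X) s → P s →
      let s′ = List.foldl (λ st _ → value step (st ∷ [])) s xs
      in P s′ × μ s′ ℕ.≤ μ s ℕ.∸ List.length xs
    loop-preserve []       s Ps = Ps , ℕ.≤-refl
    loop-preserve (x ∷ xs) s Ps with preserve s Ps
    ... | Ps′ , μ≤ with loop-preserve xs _ Ps′
    ... | Ps″ , μ≤′ = Ps″ , ℕ.≤-trans μ≤′ (ℕ.≤-trans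
      (ℕ.∸-monoˡ-≤ (List.length xs) μ≤)
      (ℕ.≤-reflexive (pred-∸ (μ s) (List.length xs))))
      where
      pred-∸ : ∀ m n → ℕ.pred m ℕ.∸ n ≡.≡ m ℕ.∸ ℕ.suc n
      pred-∸ ℕ.zero    n = ℕ.0∸n≡0 n
      pred-∸ (ℕ.suc m) n = ≡.refl

    exhaust-preserve : (xs : Term (τ ∷ []) (list σ)) (ys : Term (τ ∷ []) (list υ)) → ∀ s →
      P s → μ s ℕ.≤ List.length (value xs (s ∷ [])) ℕ.+ List.length (value ys (s ∷ [])) →
      let s′ = value (exhaust xs ys step) (s ∷ []) in P s′ × μ s′ ≡.≡ 0
    exhaust-preserve xs ys s Ps μ≤ with loop-preserve (value ys (s ∷ [])) s Ps
    ... | Ps₁ , μ≤₁ with loop-preserve (value xs (s ∷ [])) _ Ps₁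
    ... | Ps₂ , μ≤₂ = Ps₂ , ℕ.n≤0⇒n≡0 (ℕ.≤-trans μ≤₂ (ℕ.≤-trans
      (ℕ.∸-monoˡ-≤ (List.length (value xs (s ∷ []))) (ℕ.≤-trans μ≤₁
        (ℕ.∸-monoˡ-≤ (List.length (value ys (s ∷ []))) μ≤)))
      (ℕ.≤-reflexive (≡.trans
        (≡.cong (ℕ._∸ List.length (value xs (s ∷ [])))
          (ℕ.m+n∸n≡m (List.length (value xs (s ∷ []))) (List.length (value ys (s ∷ [])))))
        (ℕ.n∸n≡0 (List.length (value xs (s ∷ []))))))))

-- Trajectories

module Trajectories {c ℓ₁ ℓ₂ : Level} (K : OrderedField c ℓ₁ ℓ₂) where

  open OrderedFieldProperties K
  open RealRAM K
  open Execution K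
  open Functions K using (Jump; Domain)

  SlopeOn : (Carrier → Carrier) → Carrier → Carrier → Carrier → Set (c ⊔ ℓ₁ ⊔ ℓ₂)
  SlopeOn f lo hi m = ∀ {x y} → lo ≤ x → x ≤ y → y ≤ hi → f y ≈ f x + m * (y - x)

  SlopeOn-⊆ : ∀ {f lo hi lo′ hi′ m} → lo ≤ lo′ → hi′ ≤ hi →
              SlopeOn f lo hi m → SlopeOn f lo′ hi′ m
  SlopeOn-⊆ lo≤ ≤hi slope lo≤x x≤y y≤hi = slope (≤-trans lo≤ lo≤x) x≤y (≤-trans y≤hi ≤hi)

  -- On D, the slope of U is the value of the step function (u , js).
  Slopes : (Carrier → Carrier) → Domain → Carrier → List Jump → Set (c ⊔ ℓ₁ ⊔ ℓ₂)
  Slopes U D u []                 =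
    ∀ {x y} → D x → D y → x ≤ y → U y ≈ U x + u * (y - x)
  Slopes U D u ((p , v , w) ∷ js) =
    (∀ {x y} → D x → D y → x ≤ y → y ≤ p → U y ≈ U x + u * (y - x)) ×
    Slopes U (λ x → D x × p ≤ x) w js

  Slopes-resp : ∀ {U V} {D E : Domain} {u} js → (∀ {x} → E x → D x) →
                (∀ {x} → E x → V x ≈ U x) → Slopes U D u js → Slopes V E u js
  Slopes-resp [] E⊆D V≈U slope Ex Ey x≤y =
    trans (V≈U Ey) (trans (slope (E⊆D Ex) (E⊆D Ey) x≤y) (+-congʳ (sym (V≈U Ex))))
  Slopes-resp (_ ∷ js) E⊆D V≈U (slope , slopes) =
    (λ Ex Ey x≤y y≤p →
      trans (V≈U Ey) (trans (slope (E⊆D Ex) (E⊆D Ey) x≤y y≤p) (+-congʳ (sym (V≈U Ex))))) ,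
    Slopes-resp js (λ (Ex , p≤x) → E⊆D Ex , p≤x) (λ (Ex , _) → V≈U Ex) slopes

  Cell : Set c
  Cell = Val CellTy

  -- A bound on the rounds still to come: a round disposes of a jump or a cell, and once the cells
  -- are gone the leftover jumps do not delay the end.
  pending : List Jump → List Cell → ℕ
  pending js []         = 0
  pending js cs@(_ ∷ _) = List.length js ℕ.+ List.length cs

  pending≤ : ∀ js cs → pending js cs ℕ.≤ List.length js ℕ.+ List.length cs
  pending≤ js []      = ℕ.z≤n
  pending≤ js (_ ∷ _) = ℕ.≤-refl

  module _ (a : Carrier → Carrier) where

    CellOn : (Carrier → Carrier) → Carrier → Cell → Carrier → Set (c ⊔ ℓ₁ ⊔ ℓ₂)
    CellOn g t (ℓ , α , γ) t′ =
      (0# ≤ ℓ × t + ℓ ≈ t′) × SlopeOn a t t′ α × SlopeOn g t t′ γ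

    data Path (g : Carrier → Carrier) : Carrier → List Cell → Carrier → Set (c ⊔ ℓ₁ ⊔ ℓ₂) where
      stop : ∀ {t T} → t ≈ T → Path g t [] T
      go   : ∀ {t t′ T cell cs} → CellOn g t cell t′ → Path g t′ cs T → Path g t (cell ∷ cs) T

    -- A path whose cells are listed backwards.
    data Trail (g : Carrier → Carrier) (t₀ : Carrier) : List Cell → Carrier → Set (c ⊔ ℓ₁ ⊔ ℓ₂) where
      start : Trail g t₀ [] t₀
      went  : ∀ {t t′ cell cs} → Trail g t₀ cs t → CellOn g t cell t′ → Trail g t₀ (cell ∷ cs) t′

    CellOn⇒≤ : ∀ {g t cell t′} → CellOn g t cell t′ → t ≤ t′
    CellOn⇒≤ ((0≤ℓ , t+ℓ≈t′) , _) = ≤-from-difference 0≤ℓ (sym t+ℓ≈t′)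

    Path⇒≤ : ∀ {g t cs T} → Path g t cs T → t ≤ T
    Path⇒≤ (stop t≈T)      = ≤-reflexive t≈T
    Path⇒≤ (go cell path)  = ≤-trans (CellOn⇒≤ cell) (Path⇒≤ path)

    Trail-ʳ++ : ∀ {g t₀ t T cs} rs → Trail g t₀ rs t → Path g t cs T → Path g t₀ (rs ʳ++ cs) T
    Trail-ʳ++ []       start             path = path
    Trail-ʳ++ (_ ∷ rs) (went trail cell) path = Trail-ʳ++ rs trail (go cell path)

    Trail⇒Path : ∀ {g t₀ t T rs} → Trail g t₀ rs t → t ≈ T → Path g t₀ (List.reverse rs) T
    Trail⇒Path {rs = rs} trail t≈T = Trail-ʳ++ rs trail (stop t≈T)

    Path-start : ∀ {g t t′ cs T} → t ≈ t′ → Path g t′ cs T → Path g t cs T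
    Path-start t≈t′ (stop t′≈T) = stop (trans t≈t′ t′≈T)
    Path-start {g} t≈t′ (go ((0≤ℓ , end) , slope-a , slope-g) path) = go
      ((0≤ℓ , trans (+-congʳ t≈t′) end) ,
       SlopeOn-⊆ {a} (≤-reflexive (sym t≈t′)) ≤-refl slope-a ,
       SlopeOn-⊆ {g} (≤-reflexive (sym t≈t′)) ≤-refl slope-g)
      path

    -- Sweeping adds σ * U (k t) to the cost g t, where U is the antiderivative
    -- of the step function and k the key.
    module Sweep (key weight : Program CellTy real) (k U g g′ : Carrier → Carrier)
                 (σ t₀ T : Carrier)
      (key-slope : ∀ {lo hi} cell → SlopeOn a lo hi (proj₁ (proj₂ cell)) →
                   SlopeOn k lo hi (value key (cell ∷ [])))
      (weight≈ : ∀ cell → value weight (cell ∷ []) ≈ σ * value key (cell ∷ []))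
      (k-mono : ∀ {s s′} → t₀ ≤ s → s ≤ s′ → s′ ≤ T → k s ≤ k s′)
      (g′≈ : ∀ {s} → t₀ ≤ s → s ≤ T → g′ s ≈ g s + σ * U (k s))
      (start-time : Carrier) where

      -- `D` contains the values that the key can still take. It is narrowed to the right side of
      -- every jump passed, which is where the tail of the step function describes the slopes of
      -- `U`.
      record State (st : Val SweepTy) : Set (c ⊔ Level.suc ℓ₂ ⊔ ℓ₁) where
        constructor mk
        field
          {t}   : Carrier
          {D}   : Domain
          t₀≤t  : t₀ ≤ t
          inD   : ∀ {s} → t ≤ s → s ≤ T → D (k s)
          steps : Slopes U D (proj₁ (proj₁ (proj₂ st))) (proj₂ (proj₁ (proj₂ st)))
          key≈  : proj₁ st ≈ k t
          trail : Trail g′ start-time (proj₂ (proj₂ (proj₂ st))) t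
          path  : Path g t (proj₁ (proj₂ (proj₂ st))) T

      remaining : Val SweepTy → ℕ
      remaining st = pending (proj₂ (proj₁ (proj₂ st))) (proj₁ (proj₂ (proj₂ st)))

      -- The chain rule for affine pieces: `U` has slope `u` in the key and the key has slope `κ` in
      -- time, so the cost slope grows by `u * (σ * κ)`. The weight is read from the original cell,
      -- whose duration `ℓ₀` may differ from the emitted `ℓ`.
      emit-cell : ∀ {lo hi ℓ α γ u} → t₀ ≤ lo → hi ≤ T → 0# ≤ ℓ → lo + ℓ ≈ hi →
        SlopeOn a lo hi α → SlopeOn g lo hi γ →
        (∀ {x y} → lo ≤ x → x ≤ y → y ≤ hi → U (k y) ≈ U (k x) + u * (k y - k x)) →
        ∀ ℓ₀ → CellOn g′ lo (ℓ , α , γ + u * value weight ((ℓ₀ , α , γ) ∷ [])) hi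
      emit-cell {lo} {hi} {ℓ} {α} {γ} {u} t₀≤lo hi≤T 0≤ℓ lo+ℓ≈hi slope-a slope-g slope-U ℓ₀ =
        (0≤ℓ , lo+ℓ≈hi) , slope-a , λ {x} {y} lo≤x x≤y y≤hi →
        let κ = value key ((ℓ₀ , α , γ) ∷ [])
            ω = value weight ((ℓ₀ , α , γ) ∷ [])
        in begin
          g′ y  ≈⟨ g′≈ (≤-trans t₀≤lo (≤-trans lo≤x x≤y)) (≤-trans y≤hi hi≤T) ⟩
          g y + σ * U (k y)
            ≈⟨ +-cong (slope-g lo≤x x≤y y≤hi) (*-congˡ (slope-U lo≤x x≤y y≤hi)) ⟩
          g x + γ * (y - x) + σ * (U (k x) + u * (k y - k x))
            ≈⟨ +-congˡ (*-congˡ (+-congˡ (*-congˡ (+-congʳ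
                 (key-slope (ℓ₀ , α , γ) slope-a lo≤x x≤y y≤hi))))) ⟩
          g x + γ * (y - x) + σ * (U (k x) + u * (k x + κ * (y - x) - k x))
            ≈⟨ solve 9 (λ gx γ y x σ Ux u kx κ →
                 gx :+ γ :* (y :- x) :+ σ :* (Ux :+ u :* (kx :+ κ :* (y :- x) :- kx))
                 := gx :+ σ :* Ux :+ (γ :+ u :* (σ :* κ)) :* (y :- x))
               refl (g x) γ y x σ (U (k x)) u (k x) κ ⟩
          g x + σ * U (k x) + (γ + u * (σ * κ)) * (y - x)
            ≈⟨ +-cong (sym (g′≈ (≤-trans t₀≤lo lo≤x) (≤-trans x≤y (≤-trans y≤hi hi≤T))))
                      (*-congʳ (+-congˡ (*-congˡ (sym (weight≈ (ℓ₀ , α , γ)))))) ⟩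
          g′ x + (γ + u * ω) * (y - x)  ∎
        where open import Relation.Binary.Reasoning.Setoid setoid

      key-after : ∀ {κ₀ t t′ ℓ} m → κ₀ ≈ k t → t + ℓ ≈ t′ → t ≤ t′ → SlopeOn k t t′ m →
                  κ₀ + m * ℓ ≈ k t′
      key-after {κ₀} {t} {t′} {ℓ} m κ₀≈ t+ℓ≈t′ t≤t′ slope = begin
        κ₀ + m * ℓ            ≈⟨ +-cong κ₀≈ (*-congˡ
          (trans (solve 2 (λ ℓ t → ℓ := t :+ ℓ :- t) refl ℓ t) (+-congʳ t+ℓ≈t′))) ⟩
        k t + m * (t′ - t)    ≈⟨ slope ≤-refl t≤t′ ≤-refl ⟨
        k t′                  ∎
        where open import Relation.Binary.Reasoning.Setoid setoid

      finish : ∀ {κ₀ u js cell cs out} → (st : State (κ₀ , (u , js) , cell ∷ cs , out)) →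
        (∀ {t′ x y} → CellOn g (State.t st) cell t′ → t′ ≤ T → State.t st ≤ x → x ≤ y → y ≤ t′ →
          U (k y) ≈ U (k x) + u * (k y - k x)) →
        State (value (SweepProgram.finishCell key weight v₀ v₁ v₂)
                ((κ₀ , (u , js) , cell ∷ cs , out) ∷ cell ∷ cs ∷ []))
      finish {cell = ℓ , α , γ} (mk {t} {D} t₀≤t inD steps key≈ trail
                (go {t′ = t′} on@((0≤ℓ , t+ℓ≈t′) , slope-a , slope-g) path)) slope-U =
        mk {t = t′} {D = D} (≤-trans t₀≤t t≤t′) (λ t′≤s → inD (≤-trans t≤t′ t′≤s)) steps
          (key-after (value key ((ℓ , α , γ) ∷ [])) key≈ t+ℓ≈t′ t≤t′ (key-slope (ℓ , α , γ) slope-a))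
          (went trail (emit-cell t₀≤t (Path⇒≤ path) 0≤ℓ t+ℓ≈t′ slope-a slope-g
            (slope-U on (Path⇒≤ path)) ℓ))
          path
        where
        t≤t′ : t ≤ t′
        t≤t′ = CellOn⇒≤ {g} {cell = ℓ , α , γ} on

      -- The key is below `p` now and at least `p` at the end of the cell, so its slope is positive
      -- and it equals `p` at a time `s` in between. By monotonicity it is at most `p` until `s` and
      -- at least `p` from there on, so the two parts fall into consecutive pieces of the step
      -- function.
      cut : ∀ {κ₀ u js p v w cell cs out} →
        (st : State (κ₀ , (u , (p , v , w) ∷ js) , cell ∷ cs , out)) →
        ¬ p ≤ κ₀ → p ≤ κ₀ + value key (cell ∷ []) * proj₁ cell →
        State (value (SweepProgram.cutCell key weight v₀ v₁ v₂ v₃ v₄)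
                ((κ₀ , (u , (p , v , w) ∷ js) , cell ∷ cs , out) ∷ cell ∷ cs ∷ (p , v , w) ∷ js ∷ []))
      cut {κ₀} {u} {js} {p} {cell = cell@(ℓ , α , γ)} (mk {t} {D} t₀≤t inD (slope-U , steps) key≈ trail
            (go {t′ = t′} ((0≤ℓ , t+ℓ≈t′) , slope-a , slope-g) path)) p≰κ₀ p≤end =
        mk {t = s} {D = λ x → D x × p ≤ x} (≤-trans t₀≤t t≤s)
          (λ s≤x x≤T → inD (≤-trans t≤s s≤x) x≤T ,
            ≤-respˡ-≈ ks≈p (k-mono (≤-trans t₀≤t t≤s) s≤x x≤T))
          steps (sym ks≈p)
          (went trail (emit-cell t₀≤t s≤T 0≤ℓ′ refl (SlopeOn-⊆ ≤-refl s≤t′ slope-a)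
            (SlopeOn-⊆ ≤-refl s≤t′ slope-g)
            (λ t≤x x≤y y≤s → slope-U
              (inD t≤x (≤-trans x≤y (≤-trans y≤s s≤T)))
              (inD (≤-trans t≤x x≤y) (≤-trans y≤s s≤T))
              (k-mono (≤-trans t₀≤t t≤x) x≤y (≤-trans y≤s s≤T))
              (≤-respʳ-≈ ks≈p (k-mono (≤-trans t₀≤t (≤-trans t≤x x≤y)) y≤s s≤T)))
            ℓ))
          (go ((x≤y⇒0≤y-x ℓ′≤ℓ ,
                trans (solve 3 (λ t ℓ′ ℓ → t :+ ℓ′ :+ (ℓ :- ℓ′) := t :+ ℓ) refl t ℓ′ ℓ) t+ℓ≈t′) ,
               SlopeOn-⊆ t≤s ≤-refl slope-a , SlopeOn-⊆ t≤s ≤-refl slope-g) path)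
        where
        κ ℓ′ s : Carrier
        κ = value key (cell ∷ [])
        ℓ′ = (p - κ₀) * κ ⁻¹
        s = t + ℓ′
        κ₀<p : κ₀ < p
        κ₀<p = ≰⇒> p≰κ₀
        0<κ : 0# < κ
        0<κ with ≤-or-< κ 0#
        ... | inj₂ 0<κ = 0<κ
        ... | inj₁ κ≤0 = contradiction
          (≤-trans p≤end (≤-from-difference (*-nonneg (x≤0⇒0≤-x κ≤0) 0≤ℓ)
            (solve 3 (λ k κ ℓ → k := k :+ κ :* ℓ :+ (:- κ) :* ℓ) refl κ₀ κ ℓ)))
          p≰κ₀
        κℓ′≈ : κ * ℓ′ ≈ p - κ₀
        κℓ′≈ = trans (solve 3 (λ κ d i → κ :* (d :* i) := d :* (κ :* i)) refl κ (p - κ₀) (κ ⁻¹))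
          (trans (*-congˡ (*-inverseʳ κ (λ κ≈0 → proj₂ 0<κ (sym κ≈0)))) (*-identityʳ _))
        0≤ℓ′ : 0# ≤ ℓ′
        0≤ℓ′ = *-nonneg (proj₁ (x<y⇒0<y-x κ₀<p)) (proj₁ (⁻¹-pos 0<κ))
        ℓ′≤ℓ : ℓ′ ≤ ℓ
        ℓ′≤ℓ = *-cancelˡ-≤ 0<κ (≤-respˡ-≈ (sym κℓ′≈) (≤-from-difference (x≤y⇒0≤y-x p≤end)
          (solve 3 (λ e p k → e := p :- k :+ (k :+ e :- p)) refl (κ * ℓ) p κ₀)))
        t≤s : t ≤ s
        t≤s = x≤x+d 0≤ℓ′
        s≤t′ : s ≤ t′
        s≤t′ = ≤-respʳ-≈ t+ℓ≈t′ (+-monoʳ-≤ t ℓ′≤ℓ)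
        s≤T : s ≤ T
        s≤T = ≤-trans s≤t′ (Path⇒≤ path)
        ks≈p : k s ≈ p
        ks≈p = trans
          (sym (key-after κ key≈ refl t≤s (SlopeOn-⊆ ≤-refl s≤t′ (key-slope cell slope-a))))
          (trans (+-congˡ κℓ′≈) (solve 2 (λ k p → k :+ (p :- k) := p) refl κ₀ p))

      step-preserve : ∀ st → State st →
        State (value (sweepStep key weight) (st ∷ [])) ×
        remaining (value (sweepStep key weight) (st ∷ [])) ℕ.≤ ℕ.pred (remaining st)
      step-preserve st@(_ , (_ , _) , [] , _) inv = inv , ℕ.z≤n
      step-preserve (κ₀ , (u , []) , cell ∷ cs , out) inv@(mk t₀≤t inD steps _ _ _) =
        finish inv (λ _ t′≤T t≤x x≤y y≤t′ → steps
          (inD t≤x (≤-trans x≤y (≤-trans y≤t′ t′≤T)))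
          (inD (≤-trans t≤x x≤y) (≤-trans y≤t′ t′≤T))
          (k-mono (≤-trans t₀≤t t≤x) x≤y (≤-trans y≤t′ t′≤T))) ,
        pending≤ [] cs
      step-preserve (κ₀ , (u , (p , v , w) ∷ js) , cell ∷ cs , out) inv
        with p ≤? κ₀
      ... | yes p≤κ₀ = skip inv , ℕ.≤-refl
        where
        skip : State (κ₀ , (u , (p , v , w) ∷ js) , cell ∷ cs , out) →
               State (κ₀ , (w , js) , cell ∷ cs , out)
        skip (mk {t} {D} t₀≤t inD (_ , steps) key≈ trail path) =
          mk {D = λ x → D x × p ≤ x} t₀≤t
            (λ t≤s s≤T → inD t≤s s≤T ,
              ≤-trans p≤κ₀ (≤-respˡ-≈ (sym key≈) (k-mono t₀≤t t≤s s≤T)))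
            steps key≈ trail path
      ... | no p≰κ₀ with p ≤? (κ₀ + value key (cell ∷ []) * proj₁ cell)
      ... | yes p≤end = cut inv p≰κ₀ p≤end , ℕ.≤-refl
      ... | no p≰end = finish inv slope-U ,
        ℕ.≤-trans
          (pending≤ ((p , v , w) ∷ js) cs)
          (ℕ.≤-reflexive (≡.sym (ℕ.+-suc (List.length js) (List.length cs))))
        where
        open State inv
        slope-U : ∀ {t′ x y} → CellOn g t cell t′ → t′ ≤ T → t ≤ x → x ≤ y → y ≤ t′ →
                  U (k y) ≈ U (k x) + u * (k y - k x)
        slope-U on@((0≤ℓ , t+ℓ≈t′) , slope-a , _) t′≤T t≤x x≤y y≤t′ = proj₁ steps
          (inD t≤x (≤-trans x≤y (≤-trans y≤t′ t′≤T)))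
          (inD (≤-trans t≤x x≤y) (≤-trans y≤t′ t′≤T))
          (k-mono (≤-trans t₀≤t t≤x) x≤y (≤-trans y≤t′ t′≤T))
          (≤-trans (k-mono (≤-trans t₀≤t (≤-trans t≤x x≤y)) y≤t′ t′≤T)
            (≤-respˡ-≈ (key-after (value key (cell ∷ [])) key≈ t+ℓ≈t′
              (CellOn⇒≤ {g} {cell = cell} on) (key-slope cell slope-a)) (≰⇒≥ p≰end)))

      abstract
        sweep-trail : ∀ st → State st →
          Σ[ t ∈ Carrier ] t ≈ T × Trail g′ start-time (value (sweep key weight) (st ∷ [])) t
        sweep-trail st inv = result _ (exhaust-preserve (sweepStep key weight) State remaining step-preserve
            (snd (fst (snd v₀))) (fst (snd (snd v₀))) st inv
            (pending≤ (proj₂ (proj₁ (proj₂ st))) (proj₁ (proj₂ (proj₂ st)))))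
          where
          result : ∀ st → State st × remaining st ≡.≡ 0 →
                   Σ[ t ∈ Carrier ] t ≈ T × Trail g′ start-time (proj₂ (proj₂ (proj₂ st))) t
          result (_ , _ , [] , _) (mk _ _ _ _ trail (stop t≈T) , _) = _ , t≈T , trail
          result (_ , (_ , []) , _ ∷ _ , _) (_ , ())
          result (_ , (_ , _ ∷ _) , _ ∷ _ , _) (_ , ())

-- Piecewise linear functions

module PiecewiseLinear {c ℓ₁ ℓ₂ : Level} (K : OrderedField c ℓ₁ ℓ₂) where

  open OrderedFieldProperties K
  open RealRAM K
  open Functions K
  open Trajectories K
  open Max totalOrder using (⊔-cong; x≤y⇒x⊔y≈y; x≤y⇒y⊔x≈y)
  open Min totalOrder using (⊓-cong; x≤y⇒x⊓y≈x; x≤y⇒y⊓x≈x)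

  integrateStep-cong : ∀ u js {x x′ y y′} → x ≈ x′ → y ≈ y′ →
                       integrateStep u js x y ≈ integrateStep u js x′ y′
  integrateStep-cong u []                 x≈ y≈ = *-congˡ (+-cong y≈ (-‿cong x≈))
  integrateStep-cong u ((p , v , w) ∷ js) x≈ y≈ = +-cong
    (*-congˡ (+-cong (⊓-cong y≈ refl) (-‿cong (⊓-cong x≈ refl))))
    (integrateStep-cong w js (⊔-cong x≈ refl) (⊔-cong y≈ refl))

  -- Each piece is a value times a difference of clipped ends, so the sums telescope, in whatever
  -- order the three points lie.
  integrateStep-additive : ∀ u js x y z →
    integrateStep u js x z ≈ integrateStep u js x y + integrateStep u js y z
  integrateStep-additive u [] x y z =
    solve 4 (λ u x y z → u :* (z :- x) := u :* (y :- x) :+ u :* (z :- y)) refl u x y z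
  integrateStep-additive u ((p , v , w) ∷ js) x y z = trans
    (+-congˡ (integrateStep-additive w js (x ⊔ᴷ p) (y ⊔ᴷ p) (z ⊔ᴷ p)))
    (solve 6 (λ u x y z i j → u :* (z :- x) :+ (i :+ j)
                              := u :* (y :- x) :+ i :+ (u :* (z :- y) :+ j))
      refl u (x ⊓ p) (y ⊓ p) (z ⊓ p) _ _)

  -- Additivity at a single point says that the integral equals its own double.
  integrateStep-empty : ∀ u js x → integrateStep u js x x ≈ 0#
  integrateStep-empty u js x = trans
    (solve 1 (λ i → i := i :+ i :- i) refl (integrateStep u js x x))
    (trans (+-congʳ (sym (integrateStep-additive u js x x x))) (-‿inverseʳ _))

  -- Left of `p`, clipping leaves the first piece alone and reduces the rest to the empty interval
  -- at `p`; right of `p` it is the first piece that becomes empty.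
  integrateStep-slopes : ∀ {U} {D : Domain} u js →
    (∀ {x y} → D x → D y → x ≤ y → U y ≈ U x + integrateStep u js x y) → Slopes U D u js
  integrateStep-slopes u [] U-integral = U-integral
  integrateStep-slopes {U} {D} u ((p , v , w) ∷ js) U-integral =
    (λ {x} {y} Dx Dy x≤y y≤p → trans (U-integral Dx Dy x≤y) (+-congˡ (begin
      u * ((y ⊓ p) - (x ⊓ p)) + integrateStep w js (x ⊔ᴷ p) (y ⊔ᴷ p)
        ≈⟨ +-cong (*-congˡ (+-cong (x≤y⇒x⊓y≈x y≤p) (-‿cong (x≤y⇒x⊓y≈x (≤-trans x≤y y≤p)))))
                  (integrateStep-cong w js (x≤y⇒x⊔y≈y (≤-trans x≤y y≤p)) (x≤y⇒x⊔y≈y y≤p)) ⟩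
      u * (y - x) + integrateStep w js p p  ≈⟨ +-congˡ (integrateStep-empty w js p) ⟩
      u * (y - x) + 0#                      ≈⟨ +-identityʳ _ ⟩
      u * (y - x)                           ∎))) ,
    integrateStep-slopes w js λ {x} {y} (Dx , p≤x) (Dy , p≤y) x≤y →
      trans (U-integral Dx Dy x≤y) (+-congˡ (begin
        u * ((y ⊓ p) - (x ⊓ p)) + integrateStep w js (x ⊔ᴷ p) (y ⊔ᴷ p)
          ≈⟨ +-cong (*-congˡ (+-cong (x≤y⇒y⊓x≈x p≤y) (-‿cong (x≤y⇒y⊓x≈x p≤x))))
                    (integrateStep-cong w js (x≤y⇒y⊔x≈y p≤x) (x≤y⇒y⊔x≈y p≤y)) ⟩
        u * (p - p) + integrateStep w js x y
          ≈⟨ solve 3 (λ u p i → u :* (p :- p) :+ i := i) refl u p _ ⟩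
        integrateStep w js x y  ∎))
    where open import Relation.Binary.Reasoning.Setoid setoid

  slope : Point → Point → Carrier
  slope (p , y) (q , z) = (z - y) * (q - p) ⁻¹

  Increasing : Point → List Point → Set _
  Increasing (p , y) ps = StrictlySorted (p ∷ List.map proj₁ ps)

  first≤last : ∀ P ps → Increasing P ps → proj₁ P ≤ lastTime (P ∷ ps)
  first≤last P []       _           = ≤-refl
  first≤last P (Q ∷ ps) (p<q ∷ inc) = ≤-trans (proj₁ p<q) (first≤last Q ps inc)

  slope-times-length : ∀ {p y q z} → p < q → slope (p , y) (q , z) * (q - p) ≈ z - y
  slope-times-length {p} {y} {q} {z} p<q = trans
    (solve 3 (λ d i l → d :* i :* l := d :* (l :* i)) refl (z - y) ((q - p) ⁻¹) (q - p))
    (trans (*-congˡ (*-inverseʳ (q - p) λ e → proj₂ (x<y⇒0<y-x p<q) (sym e))) (*-identityʳ _))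

  interpolate-cong : ∀ m P ps {s t} → s ≈ t → interpolate m P ps s ≈ interpolate m P ps t
  interpolate-cong m (p , y) []             s≈t = +-congˡ (*-congˡ (+-congʳ s≈t))
  interpolate-cong m (p , y) ((q , z) ∷ ps) {s} {t} s≈t with s ≤? q | t ≤? q
  ... | yes _   | yes _   = +-congˡ (*-congˡ (+-congʳ s≈t))
  ... | no  _   | no  _   = interpolate-cong m (q , z) ps s≈t
  ... | yes s≤q | no t≰q  = contradiction (≤-respˡ-≈ s≈t s≤q) t≰q
  ... | no s≰q  | yes t≤q = contradiction (≤-respˡ-≈ (sym s≈t) t≤q) s≰q

  interpolate-start : ∀ m p y ps {t} → Increasing (p , y) ps → t ≈ p →
                      interpolate m (p , y) ps t ≈ y
  interpolate-start m p y [] {t} _ t≈p = trans (+-congˡ (*-congˡ (+-congʳ t≈p)))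
    (solve 3 (λ y m p → y :+ m :* (p :- p) := y) refl y m p)
  interpolate-start m p y ((q , z) ∷ ps) {t} (p<q ∷ _) t≈p with t ≤? q
  ... | yes _ = trans (+-congˡ (*-congˡ (+-congʳ t≈p)))
    (solve 3 (λ y m p → y :+ m :* (p :- p) := y) refl y (slope (p , y) (q , z)) p)
  ... | no t≰q = contradiction (≤-respˡ-≈ (sym t≈p) (proj₁ p<q)) t≰q

  interpolate-first : ∀ m P Q ps → SlopeOn (interpolate m P (Q ∷ ps)) (proj₁ P) (proj₁ Q) (slope P Q)
  interpolate-first m P@(p , y₀) Q@(q , z) ps {x} {y} p≤x x≤y y≤q with x ≤? q | y ≤? q
  ... | yes _   | yes _   =
    solve 5 (λ y₀ m y x p → y₀ :+ m :* (y :- p) := y₀ :+ m :* (x :- p) :+ m :* (y :- x))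
      refl y₀ (slope P Q) y x p
  ... | no x≰q  | _       = contradiction (≤-trans x≤y y≤q) x≰q
  ... | yes _   | no y≰q  = contradiction y≤q y≰q

  -- Only at `x ≈ q` does evaluation still use the first piece, and there both formulas give `z`.
  interpolate-rest : ∀ m P Q ps {x} → Increasing P (Q ∷ ps) → proj₁ Q ≤ x →
                     interpolate m P (Q ∷ ps) x ≈ interpolate m Q ps x
  interpolate-rest m P@(p , y) Q@(q , z) ps {x} (p<q ∷ inc) q≤x with x ≤? q
  ... | no  _   = refl
  ... | yes x≤q = begin
    y + slope P Q * (x - p)     ≈⟨ +-congˡ (*-congˡ (+-congʳ (antisym x≤q q≤x))) ⟩
    y + slope P Q * (q - p)     ≈⟨ +-congˡ (slope-times-length p<q) ⟩
    y + (z - y)                 ≈⟨ solve 2 (λ y z → y :+ (z :- y) := z) refl y z ⟩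
    z                           ≈⟨ interpolate-start m q z ps inc (antisym x≤q q≤x) ⟨
    interpolate m Q ps x        ∎
    where open import Relation.Binary.Reasoning.Setoid setoid

  interpolate-last : ∀ m p y x x′ → interpolate m (p , y) [] x′ ≈
                     interpolate m (p , y) [] x + m * (x′ - x)
  interpolate-last m p y x x′ =
    solve 5 (λ y m p x x′ → y :+ m :* (x′ :- p) := y :+ m :* (x :- p) :+ m :* (x′ :- x))
      refl y m p x x′

  -- The slopes right of the first point.
  risingSlopes : Carrier → Point → List Point → Carrier × List Jump
  risingSlopes m P []       = m , []
  risingSlopes m P (Q ∷ ps) = slope P Q , (proj₁ Q , rest , rest) ∷ proj₂ (risingSlopes m Q ps)
    where rest = proj₁ (risingSlopes m Q ps)

  risingSlopes-correct : ∀ m P ps → Increasing P ps →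
    Slopes (interpolate m P ps) (proj₁ P ≤_) (proj₁ (risingSlopes m P ps))
                                             (proj₂ (risingSlopes m P ps))
  risingSlopes-correct m (p , y) [] _ _ _ _ = interpolate-last m p y _ _
  risingSlopes-correct m P (Q ∷ ps) inc@(_ ∷ inc′) =
    (λ p≤x _ → interpolate-first m P Q ps p≤x) ,
    Slopes-resp (proj₂ (risingSlopes m Q ps)) proj₂
      (λ (_ , q≤x) → interpolate-rest m P Q ps inc q≤x)
      (risingSlopes-correct m Q ps inc′)

  -- The slopes of x ↦ f (- x), given those right of the first point and the
  -- slope of f left of it.
  fallingSlopes : Carrier → Carrier → Point → List Jump → List Point → Carrier × List Jump
  fallingSlopes m m₀ (p , _)   js []       = 0# - m , (0# - p , 0# - m₀ , 0# - m₀) ∷ js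
  fallingSlopes m m₀ P@(p , _) js (Q ∷ ps) =
    fallingSlopes m (slope P Q) Q ((0# - p , 0# - m₀ , 0# - m₀) ∷ js) ps

  negate-≤ : ∀ {x y} → 0# - x ≤ y → 0# - y ≤ x
  negate-≤ {x} {y} -x≤y = ≤-from-difference (x≤y⇒0≤y-x -x≤y)
    (solve 2 (λ x y → x := 𝟎 :- y :+ (y :- (𝟎 :- x))) refl x y)

  negate-≤′ : ∀ {x y} → x ≤ 0# - y → y ≤ 0# - x
  negate-≤′ {x} {y} x≤-y = ≤-from-difference (x≤y⇒0≤y-x x≤-y)
    (solve 2 (λ x y → 𝟎 :- x := y :+ (𝟎 :- y :- x)) refl x y)

  negate-mono : ∀ {x y} → x ≤ y → 0# - y ≤ 0# - x
  negate-mono {x} {y} x≤y = ≤-from-difference (x≤y⇒0≤y-x x≤y)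
    (solve 2 (λ x y → 𝟎 :- x := 𝟎 :- y :+ (y :- x)) refl x y)

  reflect-slope : ∀ {fx fy m x y : Carrier} → fx ≈ fy + m * ((0# - x) - (0# - y)) →
                  fy ≈ fx + (0# - m) * (y - x)
  reflect-slope {fx} {fy} {m} {x} {y} eq = trans
    (solve 4 (λ fy m x y → fy := fy :+ m :* (𝟎 :- x :- (𝟎 :- y)) :+ (𝟎 :- m) :* (y :- x))
      refl fy m x y)
    (+-congʳ (sym eq))

  -- Larger breakpoints of `f` have mirror images further to the left, so each step prepends a piece
  -- to the region right of `0# - p`, which `js` already describes.
  fallingSlopes-correct : ∀ {f : Carrier → Carrier} {D : Domain} m m₀ P js ps → Increasing P ps →
    (∀ {x} → proj₁ P ≤ x → f x ≈ interpolate m P ps x) →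
    Slopes (λ x → f (0# - x)) (λ x → D x × 0# - proj₁ P ≤ x) (0# - m₀) js →
    Slopes (λ x → f (0# - x)) D (proj₁ (fallingSlopes m m₀ P js ps))
                                (proj₂ (fallingSlopes m m₀ P js ps))
  fallingSlopes-correct m m₀ P@(p , y₀) js [] inc f≈ slopes =
    (λ {x} {y} Dx Dy x≤y y≤-p → reflect-slope
      (trans (f≈ (negate-≤′ (≤-trans x≤y y≤-p)))
        (trans (interpolate-last m p y₀ (0# - y) (0# - x))
               (+-congʳ (sym (f≈ (negate-≤′ y≤-p))))))) ,
    slopes
  fallingSlopes-correct {f} {D} m m₀ P@(p , _) js (Q@(q , _) ∷ ps) inc@(p<q ∷ inc′) f≈ slopes =
    fallingSlopes-correct {f} {D} m (slope P Q) Q ((0# - p , 0# - m₀ , 0# - m₀) ∷ js) ps inc′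
      (λ q≤x → trans (f≈ (≤-trans (proj₁ p<q) q≤x)) (interpolate-rest m P Q ps inc q≤x))
      ((λ (_ , -q≤x) Dy x≤y y≤-p → reflect-slope
          (trans (f≈ (negate-≤′ (≤-trans x≤y y≤-p)))
            (trans (interpolate-first m P Q ps (negate-≤′ y≤-p) (negate-mono x≤y) (negate-≤ -q≤x))
                   (+-congʳ (sym (f≈ (negate-≤′ y≤-p))))))) ,
       Slopes-resp js (λ ((Dx , _) , -p≤x) → Dx , -p≤x) (λ _ → refl) slopes)

  -- With general accumulators the recursion follows the loop, and both equations hold by
  -- computation alone.
  slopes-loop : ∀ m m₀ P js⁺ js⁻ ps →
    let r   = List.foldl (λ st Q → value slopesStep ((Q , st) ∷ [])) ((P , m₀) , js⁺ , js⁻) ps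
        out = value nextSlope ((r , m) ∷ [])
        w   = proj₁ (risingSlopes m P ps)
    in List.reverse (proj₁ (proj₂ out)) ≡.≡
         js⁺ ʳ++ ((proj₁ P , w , w) ∷ proj₂ (risingSlopes m P ps)) ×
       (0# - proj₁ out , proj₂ (proj₂ out)) ≡.≡ fallingSlopes m m₀ P js⁻ ps
  slopes-loop m m₀ P js⁺ js⁻ []       = ≡.refl , ≡.refl
  slopes-loop m m₀ P js⁺ js⁻ (Q ∷ ps) = slopes-loop m (slope P Q) Q _ _ ps

  slopes-value : ∀ m P ps →
    let w = proj₁ (risingSlopes m P ps) in
    value slopes ((P ∷ ps , m) ∷ []) ≡.≡
      ((0# , (proj₁ P , w , w) ∷ proj₂ (risingSlopes m P ps)) , fallingSlopes m 0# P [] ps)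
  slopes-value m P ps with slopes-loop m 0# P [] [] ps
  ... | rising , falling = ≡.cong₂ (λ js s → (0# , js) , s) rising falling

  module _ (f : NonDecreasingPL) where

    open NonDecreasingPL f

    private
      ps : List Point
      ps = List⁺.tail breakpoints
      P : Point
      P = List⁺.head breakpoints

    slopeSteps : Val (StepTy ⊗ StepTy)
    slopeSteps = value slopes ((List⁺.toList breakpoints , finalSlope) ∷ [])

    ⟦⟧-cong : ∀ {x y} → x ≈ y → ⟦ x ⟧ ≈ ⟦ y ⟧
    ⟦⟧-cong = interpolate-cong finalSlope P ps

    rising-correct : Slopes ⟦_⟧ (0# ≤_) (proj₁ (proj₁ slopeSteps)) (proj₂ (proj₁ slopeSteps))
    rising-correct = ≡.subst
      (λ steps → Slopes ⟦_⟧ (0# ≤_) (proj₁ (proj₁ steps)) (proj₂ (proj₁ steps)))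
      (≡.sym (slopes-value finalSlope P ps)) $
      -- As the first breakpoint is at 0, the piece before its jump lies over the single point 0,
      -- where the placeholder slope is correct.
      (λ {x} {y} 0≤x _ x≤y y≤p → trans
        (⟦⟧-cong (antisym (≤-trans y≤p (≤-trans (≤-reflexive startsAt0) 0≤x)) x≤y))
        (solve 3 (λ f x y → f := f :+ 𝟎 :* (y :- x)) refl ⟦ x ⟧ x y)) ,
      Slopes-resp (proj₂ (risingSlopes finalSlope P ps)) proj₂ (λ _ → refl)
        (risingSlopes-correct finalSlope P ps sorted)

    falling-correct : Slopes (λ x → ⟦ 0# - x ⟧) (λ x → 0# ≤ 0# - x)
                        (proj₁ (proj₂ slopeSteps)) (proj₂ (proj₂ slopeSteps))
    falling-correct = ≡.subst
      (λ steps → Slopes (λ x → ⟦ 0# - x ⟧) (λ x → 0# ≤ 0# - x) (proj₁ (proj₂ steps))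
                                                              (proj₂ (proj₂ steps)))
      (≡.sym (slopes-value finalSlope P ps)) $
      fallingSlopes-correct {⟦_⟧} {λ x → 0# ≤ 0# - x} finalSlope 0# P [] ps sorted
        (λ _ → refl)
        -- Likewise the mirrored domain has only the point 0 right of its last jump.
        (λ {x} {y} (_ , -p≤x) (0≤-y , _) x≤y → trans
          (⟦⟧-cong (antisym (negate-mono x≤y)
            (≤-trans (negate-≤ -p≤x) (≤-trans (≤-reflexive startsAt0) 0≤-y))))
          (solve 3 (λ f x y → f := f :+ (𝟎 :- 𝟎) :* (y :- x)) refl ⟦ 0# - x ⟧ x y))

-- The passes over the trajectory

module ContinuousCost {c ℓ₁ ℓ₂ : Level} (K : OrderedField c ℓ₁ ℓ₂) where

  open OrderedFieldProperties K
  open RealRAM K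
  open Execution K
  open Functions K
  open Trajectories K
  open PiecewiseLinear K

  module Overtime (A : Carrier → Carrier) (f : NonDecreasingPL) (T : Carrier)
                  (t≤A : ∀ {t} → t ≤ T → t ≤ A t) where

    module f = NonDecreasingPL f

    overtime : Carrier → Carrier
    overtime t = f.⟦ A t - t ⟧

    rising-slope : ∀ {lo hi} m → SlopeOn A lo hi m → SlopeOn (λ s → A s - s) lo hi (m - 1#)
    rising-slope m slope-A {x} {y} lo≤x x≤y y≤hi = trans (+-congʳ (slope-A lo≤x x≤y y≤hi))
      (solve 4 (λ Ax m x y → Ax :+ m :* (y :- x) :- y := Ax :- x :+ (m :- 𝟏) :* (y :- x))
        refl (A x) m x y)

    falling-slope : ∀ {lo hi} m → SlopeOn A lo hi m → SlopeOn (λ s → s - A s) lo hi (1# - m)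
    falling-slope m slope-A {x} {y} lo≤x x≤y y≤hi = trans
      (+-congˡ (-‿cong (slope-A lo≤x x≤y y≤hi)))
      (solve 4 (λ Ax m x y → y :- (Ax :+ m :* (y :- x)) := x :- Ax :+ (𝟏 :- m) :* (y :- x))
        refl (A x) m x y)

    single-cell : ∀ {t p q α} → t ≈ p → p < q → SlopeOn A t q α →
                  Path A (λ _ → 0#) t ((q - p , α , 0#) ∷ []) q
    single-cell {t} {p} {q} t≈p p<q slope-A = go
      ((proj₁ (x<y⇒0<y-x p<q) ,
        trans (+-congʳ t≈p) (solve 2 (λ p q → p :+ (q :- p) := q) refl p q)) ,
       slope-A ,
       λ {x} {y} _ _ _ → solve 2 (λ x y → 𝟎 := 𝟎 :+ 𝟎 :* (y :- x)) refl x y)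
      (stop refl)

    abstract
      -- The cost before this sweep is constantly 0, so with factor 1 the sweep produces exactly
      -- `overtime`. In both cases `t≤A` keeps the waiting time in the domain of `f`; in the falling
      -- case its negative is the key and the reflection of `f` plays the part of `U`.
      segment-trail : ∀ {t₀ t p y q z out} → t ≈ p → p < q → q ≤ T → A t ≈ y →
        SlopeOn A p q (slope (p , y) (q , z)) → Trail A overtime t₀ out t →
        Σ[ t′ ∈ Carrier ] t′ ≈ q × Trail A overtime t₀
          (proj₂ (value segmentStep (((q , z) , ((p , y) , out) , slopeSteps f) ∷ []))) t′
      segment-trail {t₀} {t} {p} {y} {q} {z} t≈p p<q q≤T At≈y slope-pq trail
        with 1# ≤? slope (p , y) (q , z)
      ... | yes 1≤α = Rising.sweep-trail _ (Rising.mk {D = 0# ≤_} ≤-refl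
          (λ t≤s s≤q → x≤y⇒0≤y-x (t≤A (≤-trans s≤q q≤T)))
          (rising-correct f)
          (+-cong (sym At≈y) (-‿cong (sym t≈p)))
          trail
          (single-cell t≈p p<q slope-A))
        where
        slope-A : SlopeOn A t q (slope (p , y) (q , z))
        slope-A = SlopeOn-⊆ {A} (≤-reflexive (sym t≈p)) ≤-refl slope-pq
        module Rising = Sweep A risingKey risingKey (λ s → A s - s) f.⟦_⟧ (λ _ → 0#) overtime
          1# t q
          (λ (_ , m , _) → rising-slope m)
          (λ _ → sym (*-identityˡ _))
          (λ t≤s s≤s′ s′≤q → ≤-from-difference
            (*-nonneg (x≤y⇒0≤y-x 1≤α) (x≤y⇒0≤y-x s≤s′))
            (rising-slope _ slope-A t≤s s≤s′ s′≤q))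
          (λ {s} _ _ → solve 1 (λ x → x := 𝟎 :+ 𝟏 :* x) refl (overtime s))
          t₀
      ... | no 1≰α = Falling.sweep-trail _ (Falling.mk {D = λ x → 0# ≤ 0# - x} ≤-refl
          (λ {s} t≤s s≤q → ≤-from-difference (x≤y⇒0≤y-x (t≤A (≤-trans s≤q q≤T)))
            (solve 2 (λ s As → 𝟎 :- (s :- As) := 𝟎 :+ (As :- s)) refl s (A s)))
          (falling-correct f)
          (+-cong (sym t≈p) (-‿cong (sym At≈y)))
          trail
          (single-cell t≈p p<q slope-A))
        where
        slope-A : SlopeOn A t q (slope (p , y) (q , z))
        slope-A = SlopeOn-⊆ {A} (≤-reflexive (sym t≈p)) ≤-refl slope-pq
        module Falling = Sweep A fallingKey fallingKey (λ s → s - A s) (λ x → f.⟦ 0# - x ⟧)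
          (λ _ → 0#) overtime 1# t q
          (λ (_ , m , _) → falling-slope m)
          (λ _ → sym (*-identityˡ _))
          (λ t≤s s≤s′ s′≤q → ≤-from-difference
            (*-nonneg (x≤y⇒0≤y-x (≰⇒≥ 1≰α)) (x≤y⇒0≤y-x s≤s′))
            (falling-slope _ slope-A t≤s s≤s′ s′≤q))
          (λ {s} _ _ → trans (⟦⟧-cong f (solve 2 (λ s As → As :- s := 𝟎 :- (s :- As)) refl s (A s)))
            (solve 1 (λ x → x := 𝟎 :+ 𝟏 :* x) refl f.⟦ 0# - (s - A s) ⟧))
          t₀

    abstract
      segments-trail : ∀ {t₀ t} P ps out → Increasing P ps → t ≈ proj₁ P →
        lastTime (P ∷ ps) ≈ T →
        (∀ {s} → proj₁ P ≤ s → A s ≈ interpolate 0# P ps s) →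
        Trail A overtime t₀ out t →
        Σ[ t′ ∈ Carrier ] t′ ≈ T × Trail A overtime t₀
          (proj₂ (List.foldl (λ st Q → value segmentStep ((Q , st , slopeSteps f) ∷ []))
                             (P , out) ps)) t′
      segments-trail P [] out inc t≈p last≈ A≈ trail = _ , trans t≈p last≈ , trail
      segments-trail P@(p , y) (Q@(q , z) ∷ ps) out inc@(p<q ∷ inc′) t≈p last≈ A≈ trail
        with segment-trail t≈p p<q (≤-respʳ-≈ last≈ (first≤last Q ps inc′))
               (trans (A≈ (≤-reflexive (sym t≈p))) (interpolate-start 0# p y (Q ∷ ps) inc t≈p))
               (λ p≤x x≤y y≤q → trans (A≈ (≤-trans p≤x x≤y)) (trans
                 (interpolate-first 0# P Q ps p≤x x≤y y≤q) (+-congʳ (sym (A≈ p≤x)))))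
               trail
      ... | t′ , t′≈q , trail′ = segments-trail Q ps _ inc′ t′≈q last≈
        (λ q≤s → trans (A≈ (≤-trans (proj₁ p<q) q≤s)) (interpolate-rest 0# P Q ps inc q≤s))
        trail′

  module Continuous (a : ArrivalTimeFunction) (f : NonDecreasingPL)
                    (w : PiecewiseConstant (tMin a) (ArrivalTimeFunction.⟦_⟧ a (tMax a))) where

    module a = ArrivalTimeFunction a
    module f = NonDecreasingPL f
    module w = PiecewiseConstant w
    open Overtime a.⟦_⟧ f a.tMax a.t≤⟦t⟧ using (overtime; segments-trail)

    t₀ T : Carrier
    t₀ = a.tMin
    T  = a.tMax

    -- From `t₀` on, the constant branch applies only at `t₀` itself, where interpolation starts
    -- with the same value.
    arrival≈interpolate : ∀ {t} → t₀ ≤ t →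
      a.⟦ t ⟧ ≈ interpolate 0# (List⁺.head a.breakpoints) (List⁺.tail a.breakpoints) t
    arrival≈interpolate {t} t₀≤t with t ≤? proj₁ (List⁺.head a.breakpoints)
    ... | yes t≤t₀ = sym (interpolate-start 0# _ _ (List⁺.tail a.breakpoints) a.sorted
                           (antisym t≤t₀ t₀≤t))
    ... | no  _    = refl

    arrival-start : a.⟦ t₀ ⟧ ≈ proj₂ (List⁺.head a.breakpoints)
    arrival-start = trans (arrival≈interpolate ≤-refl)
      (interpolate-start 0# _ _ (List⁺.tail a.breakpoints) a.sorted refl)

    W : Carrier → Carrier
    W = w.∫ t₀

    W-slopes : Slopes W (λ _ → Poly.⊤) w.initial w.jumps
    W-slopes = integrateStep-slopes w.initial w.jumps
      λ {x} {y} _ _ _ → integrateStep-additive w.initial w.jumps t₀ x y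

    -- The factors are spelled out in the shape that `Sweep` expects. Together they give `W` at the
    -- arrival minus `W` at the departure, which is the waiting integral.
    cost₁ cost₂ : Carrier → Carrier
    cost₁ t = overtime t + (0# - 1#) * W t
    cost₂ t = cost₁ t + 1# * W a.⟦ t ⟧

    cost₂-cong : ∀ {s s′} → t₀ ≤ s → s ≈ s′ → cost₂ s ≈ cost₂ s′
    cost₂-cong {s} {s′} t₀≤s s≈s′ = +-cong
      (+-cong (⟦⟧-cong f (+-cong arrival≈ (-‿cong s≈s′))) (*-congˡ (W-cong s≈s′)))
      (*-congˡ (W-cong arrival≈))
      where
      W-cong : ∀ {x y} → x ≈ y → W x ≈ W y
      W-cong = integrateStep-cong w.initial w.jumps refl
      arrival≈ : a.⟦ s ⟧ ≈ a.⟦ s′ ⟧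
      arrival≈ = trans (arrival≈interpolate t₀≤s) (trans
        (interpolate-cong 0# (List⁺.head a.breakpoints) (List⁺.tail a.breakpoints) s≈s′)
        (sym (arrival≈interpolate (≤-respʳ-≈ s≈s′ t₀≤s))))

    module Clock = Sweep a.⟦_⟧ clockKey clockWeight (λ t → t) W overtime cost₁ (0# - 1#) t₀ T
      (λ _ _ {x} {y} _ _ _ → solve 2 (λ x y → y := x :+ 𝟏 :* (y :- x)) refl x y)
      (λ _ → sym (*-identityʳ _))
      (λ _ s≤s′ _ → s≤s′)
      (λ _ _ → refl)
      t₀

    module Arrival = Sweep a.⟦_⟧ arrivalKey arrivalKey a.⟦_⟧ W cost₁ cost₂ 1# t₀ T
      (λ _ slope-a → slope-a)
      (λ _ → sym (*-identityˡ _))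
      (λ _ s≤s′ s′≤T → a.nonDecreasing (≤-trans s≤s′ s′≤T) s′≤T s≤s′)
      (λ _ _ → refl)
      t₀

    TrailTo : (Carrier → Carrier) → List Cell → Set _
    TrailTo g cs = Σ[ t ∈ Carrier ] t ≈ T × Trail a.⟦_⟧ g t₀ cs t

    toPath : ∀ {g cs} → TrailTo g cs → Path a.⟦_⟧ g t₀ (List.reverse cs) T
    toPath (_ , t≈T , trail) = Trail⇒Path a.⟦_⟧ trail t≈T

    abstract
      overtime-trail : TrailTo overtime
        (value overtimePieces ((List⁺.toList a.breakpoints , slopeSteps f) ∷ []))
      overtime-trail = segments-trail (List⁺.head a.breakpoints) (List⁺.tail a.breakpoints) []
        a.sorted refl refl arrival≈interpolate start

      clock-trail : ∀ {cs} → TrailTo overtime cs → TrailTo cost₁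
        (value (addStep clockKey clockWeight) ((t₀ , (w.initial , w.jumps) , cs) ∷ []))
      clock-trail trail = Clock.sweep-trail _
        (Clock.mk {D = λ _ → Poly.⊤} ≤-refl (λ _ _ → Poly.tt) W-slopes refl start (toPath trail))

      arrival-trail : ∀ {cs} → TrailTo cost₁ cs → TrailTo cost₂
        (value (addStep arrivalKey arrivalKey)
          ((proj₂ (List⁺.head a.breakpoints) , (w.initial , w.jumps) , cs) ∷ []))
      arrival-trail trail = Arrival.sweep-trail _
        (Arrival.mk {D = λ _ → Poly.⊤} ≤-refl (λ _ _ → Poly.tt) W-slopes (sym arrival-start) start
          (toPath trail))

      cells-trail : ∀ (ca : Val StepTy) → TrailTo cost₂ (value cells
        ((List⁺.toList a.breakpoints , ca , (List⁺.toList f.breakpoints , f.finalSlope) ,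
          (w.initial , w.jumps)) ∷ []))
      cells-trail ca = arrival-trail (clock-trail overtime-trail)

    cost₂≈ : ∀ t → f.⟦ a.⟦ t ⟧ - t ⟧ + w.∫ t a.⟦ t ⟧ ≈ cost₂ t
    cost₂≈ t = trans
      (solve 3 (λ o w₀ i → o :+ i := o :+ (𝟎 :- 𝟏) :* w₀ :+ 𝟏 :* (w₀ :+ i))
        refl (overtime t) (W t) (w.∫ t a.⟦ t ⟧))
      (+-congˡ (*-congˡ (sym (integrateStep-additive w.initial w.jumps t₀ t a.⟦ t ⟧))))

-- Scanning for the least minimizer

module Scanning {c ℓ₁ ℓ₂ : Level} (K : OrderedField c ℓ₁ ℓ₂) where

  open OrderedFieldProperties K
  open RealRAM K
  open Execution K
  open Functions K
  open Trajectories K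

  evalStep-at : ∀ u p v w js {t} → t ≈ p → evalStep u ((p , v , w) ∷ js) t ≈ v
  evalStep-at u p v w js {t} t≈p with t ≟ p | t ≤? p
  ... | yes _   | _ = refl
  ... | no  t≉p | _ = contradiction t≈p t≉p

  evalStep-before : ∀ u js {t} → All (t <_) (List.map proj₁ js) → evalStep u js t ≈ u
  evalStep-before u []                 _                 = refl
  evalStep-before u ((p , v , w) ∷ js) {t} ((t≤p , t≉p) ∷ _) with t ≟ p | t ≤? p
  ... | yes t≈p | _        = contradiction t≈p t≉p
  ... | no  _   | yes _    = refl
  ... | no  _   | no  t≰p  = contradiction t≤p t≰p

  evalStep-after : ∀ u p v w js {t} → p < t → evalStep u ((p , v , w) ∷ js) t ≈ evalStep w js t
  evalStep-after u p v w js {t} p<t@(p≤t , p≉t) with t ≟ p | t ≤? p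
  ... | yes t≈p | _        = contradiction (sym t≈p) p≉t
  ... | no  _   | yes t≤p  = contradiction t≤p (<⇒≱ p<t)
  ... | no  _   | no  _    = refl

  sorted-above : ∀ {p ps} → StrictlySorted (p ∷ ps) → All (p <_) ps
  sorted-above [-]           = []
  sorted-above (p<q ∷ qs)    = p<q ∷ All.map (<-trans p<q) (sorted-above qs)

  sorted-tail : ∀ {p ps} → StrictlySorted (p ∷ ps) → StrictlySorted ps
  sorted-tail [-]      = []
  sorted-tail (_ ∷ qs) = qs

  abstract
    -- Finitely many strict upper bounds leave room in a dense order: whenever a bound is not above
    -- the point found so far, a midpoint below that bound replaces it.
    room : ∀ {t T} ps → t < T → All (t <_) ps → Σ[ s ∈ Carrier ] t < s × s < T × All (s <_) ps
    room [] t<T [] with between t<T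
    ... | s , t<s , s<T = s , t<s , s<T , []
    room {t} {T} (p ∷ ps) t<T (t<p ∷ t<ps) with room ps t<T t<ps
    ... | s , t<s , s<T , s<ps with ≤-or-< p s
    ...   | inj₂ s<p = s , t<s , s<T , s<p ∷ s<ps
    ...   | inj₁ p≤s with between t<p
    ...     | r , t<r , r<p = r , t<r , <-trans r<s s<T , r<p ∷ All.map (<-trans r<s) s<ps
      where
      r<s : r < s
      r<s = <-≤-trans r<p p≤s

  module LeastMinimizer (g A : Carrier → Carrier) (t₀ T : Carrier) (d : PiecewiseConstant t₀ T)
              (g-cong : ∀ {s s′} → t₀ ≤ s → s ≈ s′ → g s ≈ g s′)
              (lsc : LowerSemicontinuousOn [ t₀ ⋯ T ] (PiecewiseConstant.⟦_⟧ d)) where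

    module d = PiecewiseConstant d

    ca : Carrier → Carrier
    ca = d.⟦_⟧

    -- Cells carry no absolute cost, so the scan counts from 0 at `t₀`; the shift is undone in the
    -- final correctness proof.
    f : Carrier → Carrier
    f s = ca s + (g s - g t₀)

    -- A comparison by value, then by time. A candidate that beats the whole graph of `f`, with a
    -- value that `f` does not exceed there, is the least minimizer.
    Beats : Point → Point → Set _
    Beats (t , v) (s , w) = v < w ⊎ (v ≤ w × t ≤ s)

    Beats-trans : ∀ {P Q R} → Beats P Q → Beats Q R → Beats P R
    Beats-trans (inj₁ u<v)          (inj₁ v<w)          = inj₁ (<-trans u<v v<w)
    Beats-trans (inj₁ u<v)          (inj₂ (v≤w , _))    = inj₁ (<-≤-trans u<v v≤w)
    Beats-trans (inj₂ (u≤v , _))    (inj₁ v<w)          = inj₁ (≤-<-trans u≤v v<w)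
    Beats-trans (inj₂ (u≤v , r≤s))  (inj₂ (v≤w , s≤t))  = inj₂ (≤-trans u≤v v≤w , ≤-trans r≤s s≤t)

    -- l is the limit of f from the right at t.
    record Best (t l : Carrier) (best : Point) : Set (c ⊔ ℓ₁ ⊔ ℓ₂) where
      constructor mkBest
      field
        t₀≤best  : t₀ ≤ proj₁ best
        best≤t   : proj₁ best ≤ t
        attained : f (proj₁ best) ≤ proj₂ best
        beats    : ∀ {s} → t₀ ≤ s → s ≤ t → Beats best (s , f s)
        limit    : t < T → proj₂ best ≤ l

    -- `ca≈` starts strictly after `t`: the value at `t` has already been accounted for in the
    -- candidate and a jump at `t` consumed, so `u` is the value just right of `t`.
    record State′ (t G u : Carrier) (js : List Jump) (cs : List Cell) (best : Point) :
                  Set (c ⊔ ℓ₁ ⊔ ℓ₂) where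
      constructor mk
      field
        t₀≤t    : t₀ ≤ t
        path    : Path A g t cs T
        G≈      : G ≈ g t - g t₀
        ca≈     : ∀ {s} → t < s → s ≤ T → ca s ≈ evalStep u js s
        sorted  : StrictlySorted (List.map proj₁ js)
        jumps>t : All (t <_) (List.map proj₁ js)
        jumps≤T : All (_≤ T) (List.map proj₁ js)
        isBest  : Best t (u + G) best

    State : Val ScanTy → Set _
    State ((t , G) , (u , js) , cs , best) = State′ t G u js cs best

    abstract
      -- If the value `w` right of `p` were below `ca p`, lower semicontinuity would keep `ca` above
      -- `w` near `p`, although it equals `w` up to the next jump.
      right-limit : ∀ {p w v ps} → t₀ ≤ p → p < T → All (p <_) ps → v ≈ ca p →
                    (∀ {s} → p < s → s ≤ T → All (s <_) ps → ca s ≈ w) → v ≤ w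
      right-limit {p} {w} {v} {ps} t₀≤p p<T p<ps v≈ ca≈w with ≤-or-< v w
      ... | inj₁ v≤w = v≤w
      ... | inj₂ w<v with lsc (t₀≤p , proj₁ p<T) (<-respʳ-≈ v≈ w<v)
      ... | δ , 0<δ , near with room ps p<T p<ps
      -- The bound `s` keeps the new point before the next jump, the bound `p + δ` within reach of
      -- `near`.
      ... | s , p<s , s<T , s<ps with room (s ∷ []) (<-from-difference 0<δ (refl {p + δ})) (p<s ∷ [])
      ... | r , p<r , r<p+δ , r<s ∷ [] = contradiction
        (near (≤-trans t₀≤p (proj₁ p<r) , ≤-trans (proj₁ r<s) (proj₁ s<T))
              (<-trans (<-from-difference 0<δ (solve 2 (λ p δ → p := p :- δ :+ δ) refl p δ)) p<r , r<p+δ))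
        (λ w<ca → proj₂ w<ca (sym (ca≈w p<r (≤-trans (proj₁ r<s) (proj₁ s<T))
                                      (All.map (<-trans r<s) s<ps))))

    abstract
      -- The mirror image of `right-limit`; the test point lies between the larger of `t` and
      -- `p - δ` and the jump.
      left-limit : ∀ {t p u v} → t₀ ≤ t → t < p → p ≤ T → v ≈ ca p →
                   (∀ {s} → t < s → s < p → ca s ≈ u) → v ≤ u
      left-limit {t} {p} {u} {v} t₀≤t t<p p≤T v≈ ca≈u with ≤-or-< v u
      ... | inj₁ v≤u = v≤u
      ... | inj₂ u<v with lsc (≤-trans t₀≤t (proj₁ t<p) , p≤T) (<-respʳ-≈ v≈ u<v)
      ... | δ , 0<δ , near with near-below (≤-or-< t (p - δ))
        where
        p-δ<p : p - δ < p
        p-δ<p = <-from-difference 0<δ (solve 2 (λ p δ → p := p :- δ :+ δ) refl p δ)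
        near-below : t ≤ p - δ ⊎ p - δ < t → Σ[ s ∈ Carrier ] t < s × p - δ < s × s < p
        near-below (inj₁ t≤p-δ) with between p-δ<p
        ... | s , p-δ<s , s<p = s , ≤-<-trans t≤p-δ p-δ<s , p-δ<s , s<p
        near-below (inj₂ p-δ<t) with between t<p
        ... | s , t<s , s<p = s , t<s , <-trans p-δ<t t<s , s<p
      ... | s , t<s , p-δ<s , s<p = contradiction
        (near (≤-trans t₀≤t (proj₁ t<s) , ≤-trans (proj₁ s<p) p≤T)
              (p-δ<s , <-trans s<p (<-from-difference 0<δ refl)))
        (λ u<ca → proj₂ u<ca (sym (ca≈u t<s s<p)))

    abstract
      better-beats : ∀ P Q → proj₁ P ≤ proj₁ Q →
        let best = value better ((P , Q) ∷ []) in
        (best ≡.≡ P ⊎ best ≡.≡ Q) × Beats best P × Beats best Q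
      better-beats (tᵇ , vᵇ) (t , v) tᵇ≤t with vᵇ ≤? v
      ... | yes vᵇ≤v = inj₁ ≡.refl , inj₂ (≤-refl , ≤-refl) , inj₂ (vᵇ≤v , tᵇ≤t)
      ... | no  vᵇ≰v = inj₂ ≡.refl , inj₁ (≰⇒> vᵇ≰v) , inj₂ (≤-refl , ≤-refl)

    Beats⇒≤ : ∀ {P Q} → Beats P Q → proj₂ P ≤ proj₂ Q
    Beats⇒≤ (inj₁ (v≤w , _)) = v≤w
    Beats⇒≤ (inj₂ (v≤w , _)) = v≤w

    -- An affine function on [t , t′] is minimal at t or, if it is strictly
    -- decreasing, at t′; lower semicontinuity (x ≤ u, x ≤ u′) keeps the jumps of
    -- ca from spoiling this.
    advance : ∀ {t t′ u u′ x γ G G′ best} → t₀ ≤ t → t < t′ →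
      (∀ {s} → t < s → s < t′ → ca s ≈ u) → (∀ {s} → s ≈ t′ → ca s ≈ x) →
      x ≤ u → (t′ < T → x ≤ u′) → SlopeOn g t t′ γ →
      G ≈ g t - g t₀ → G′ ≈ g t′ - g t₀ → t′ ≤ T →
      Best t (u + G) best → Best t′ (u′ + G′) (value better ((best , (t′ , x + G′)) ∷ []))
    advance {t} {t′} {u} {u′} {x} {γ} {G} {G′} {best} t₀≤t t<t′ ca≈u ca≈x x≤u x≤u′ slope-g G≈ G′≈ t′≤T
            (mkBest t₀≤best best≤t attained beats limit) = mkBest
      t₀≤new new≤t′ new-attained new-beats
      (λ t′<T → ≤-trans (Beats⇒≤ beats-new) (+-monoˡ-≤ G′ (x≤u′ t′<T)))
      where
      new : Point
      new = value better ((best , (t′ , x + G′)) ∷ [])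
      compared : (new ≡.≡ best ⊎ new ≡.≡ (t′ , x + G′)) × Beats new best × Beats new (t′ , x + G′)
      compared = better-beats best (t′ , x + G′) (≤-trans best≤t (proj₁ t<t′))
      choice : new ≡.≡ best ⊎ new ≡.≡ (t′ , x + G′)
      choice = proj₁ compared
      beats-old : Beats new best
      beats-old = proj₁ (proj₂ compared)
      beats-new : Beats new (t′ , x + G′)
      beats-new = proj₂ (proj₂ compared)
      by-choice : ∀ {p} (P : Point → Set p) → P best → P (t′ , x + G′) → P new
      by-choice P Pb Pn with choice
      ... | inj₁ eq = ≡.subst P (≡.sym eq) Pb
      ... | inj₂ eq = ≡.subst P (≡.sym eq) Pn
      f-at : ∀ {s} → t ≤ s → s ≈ t′ → f s ≈ x + G′
      f-at {s} t≤s s≈t′ = +-cong (ca≈x s≈t′) (trans (+-congʳ (trans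
        (solve 3 (λ gs γ s → gs := gs :+ γ :* (s :- s)) refl (g s) γ s)
        (trans (+-congˡ (*-congˡ (+-congʳ s≈t′)))
               (sym (slope-g t≤s (≤-reflexive s≈t′) ≤-refl)))))
        (sym G′≈))
      t₀≤new : t₀ ≤ proj₁ new
      t₀≤new = by-choice (λ P → t₀ ≤ proj₁ P)
        t₀≤best (≤-trans t₀≤t (proj₁ t<t′))
      new≤t′ : proj₁ new ≤ t′
      new≤t′ = by-choice (λ P → proj₁ P ≤ t′)
        (≤-trans best≤t (proj₁ t<t′)) (≤-refl)
      new-attained : f (proj₁ new) ≤ proj₂ new
      new-attained = by-choice (λ P → f (proj₁ P) ≤ proj₂ P)
        attained (≤-reflexive (f-at (proj₁ t<t′) refl))
      inside : ∀ {s} → t < s → s < t′ → Beats new (s , f s)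
      inside {s} t<s s<t′ with ≤-or-< 0# γ
      ... | inj₁ 0≤γ = Beats-trans beats-old (inj₂
        (≤-trans (limit (<-≤-trans t<t′ t′≤T)) (≤-respʳ-≈ (+-congʳ (sym (ca≈u t<s s<t′)))
          (+-monoʳ-≤ u (≤-from-difference (*-nonneg 0≤γ (x≤y⇒0≤y-x (proj₁ t<s)))
            (trans (+-congʳ (slope-g ≤-refl (proj₁ t<s) (proj₁ s<t′)))
              (trans (solve 3 (λ a d b → a :+ d :- b := a :- b :+ d) refl (g t) (γ * (s - t)) (g t₀))
                     (+-congʳ (sym G≈))))))) ,
         ≤-trans best≤t (proj₁ t<s)))
      ... | inj₂ γ<0 = inj₁ (≤-<-trans (≤-trans (Beats⇒≤ beats-new) (+-monoˡ-≤ G′ x≤u))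
        (<-from-difference (*-pos (x<y⇒0<y-x γ<0) (x<y⇒0<y-x s<t′)) (begin
          ca s + (g s - g t₀)                   ≈⟨ +-congʳ (ca≈u t<s s<t′) ⟩
          u + (g s - g t₀)
            ≈⟨ solve 6 (λ u gs b γ t′ s → u :+ (gs :- b) :=
                 u :+ (gs :+ γ :* (t′ :- s) :- b) :+ (𝟎 :- γ) :* (t′ :- s))
               refl u (g s) (g t₀) γ t′ s ⟩
          u + (g s + γ * (t′ - s) - g t₀) + (0# - γ) * (t′ - s)
            ≈⟨ +-congʳ (+-congˡ (trans (+-congʳ (sym (slope-g (proj₁ t<s) (proj₁ s<t′) ≤-refl)))
                                       (sym G′≈))) ⟩
          u + G′ + (0# - γ) * (t′ - s)          ∎)))
        where open import Relation.Binary.Reasoning.Setoid setoid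
      new-beats : ∀ {s} → t₀ ≤ s → s ≤ t′ → Beats new (s , f s)
      new-beats {s} t₀≤s s≤t′ with ≤-or-< s t | ≤-or-< t′ s
      ... | inj₁ s≤t | _         = Beats-trans beats-old (beats t₀≤s s≤t)
      ... | inj₂ t<s | inj₂ s<t′ = inside t<s s<t′
      ... | inj₂ t<s | inj₁ t′≤s = Beats-trans beats-new
        (inj₂ (≤-reflexive (sym (f-at (proj₁ t<s) (antisym s≤t′ t′≤s))) , t′≤s))

    moved-cost : ∀ {t t′ s γ G ℓ} → SlopeOn g t t′ γ → G ≈ g t - g t₀ → t ≤ s → s ≤ t′ →
                 ℓ ≈ s - t → G + γ * ℓ ≈ g s - g t₀
    moved-cost {t} {t′} {s} {γ} {G} {ℓ} slope-g G≈ t≤s s≤t′ ℓ≈ = begin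
      G + γ * ℓ                      ≈⟨ +-cong G≈ (*-congˡ ℓ≈) ⟩
      g t - g t₀ + γ * (s - t)       ≈⟨ solve 3 (λ a b d → a :- b :+ d := a :+ d :- b)
                                         refl (g t) (g t₀) (γ * (s - t)) ⟩
      g t + γ * (s - t) - g t₀       ≈⟨ +-congʳ (slope-g ≤-refl t≤s s≤t′) ⟨
      g s - g t₀                     ∎
      where open import Relation.Binary.Reasoning.Setoid setoid

    -- No jump lies after `t` up to the end of the cell, so `ca` is `u` there and `advance` applies
    -- with all three values equal to `u`. A cell of duration 0 extends the covered range by
    -- nothing, and the candidate is kept.
    cell-step : ∀ {t G u js cell cs best} → State ((t , G) , (u , js) , cell ∷ cs , best) →
      All (t + proj₁ cell <_) (List.map proj₁ js) →
      State (value (scanCell v₀ v₁ v₂) (((t , G) , (u , js) , cell ∷ cs , best) ∷ cell ∷ cs ∷ []))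
    cell-step {t} {G} {u} {js} {cell@(ℓ , α , γ)} {cs} {best}
              (mk t₀≤t (go {t′ = t′} ((0≤ℓ , t+ℓ≈t′) , _ , slope-g) path) G≈ ca≈ sorted _ jumps≤T isBest)
              jumps>t⁺ =
      mk (≤-trans t₀≤t t≤t⁺) (Path-start A t+ℓ≈t′ path) G⁺≈
         (λ t⁺<s → ca≈ (≤-<-trans t≤t⁺ t⁺<s)) sorted jumps>t⁺ jumps≤T best⁺
      where
      t⁺ G⁺ : Carrier
      t⁺ = t + ℓ
      G⁺ = G + γ * ℓ
      t≤t⁺ : t ≤ t⁺
      t≤t⁺ = x≤x+d 0≤ℓ
      t⁺≤T : t⁺ ≤ T
      t⁺≤T = ≤-respˡ-≈ (sym t+ℓ≈t′) (Path⇒≤ A path)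
      slope-g⁺ : SlopeOn g t t⁺ γ
      slope-g⁺ = SlopeOn-⊆ {g} ≤-refl (≤-reflexive t+ℓ≈t′) slope-g
      G⁺≈ : G⁺ ≈ g t⁺ - g t₀
      G⁺≈ = moved-cost slope-g⁺ G≈ t≤t⁺ ≤-refl (solve 2 (λ t ℓ → ℓ := t :+ ℓ :- t) refl t ℓ)
      ca≈u : ∀ {s} → t < s → s ≤ t⁺ → ca s ≈ u
      ca≈u t<s s≤t⁺ = trans (ca≈ t<s (≤-trans s≤t⁺ t⁺≤T))
        (evalStep-before u js (All.map (≤-<-trans s≤t⁺) jumps>t⁺))
      best⁺ : Best t⁺ (u + G⁺) (proj₂ (proj₂ (proj₂
        (value (scanCell v₀ v₁ v₂) (((t , G) , (u , js) , cell ∷ cs , best) ∷ cell ∷ cs ∷ [])))))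
      best⁺ with ℓ ≤? 0#
      ... | no ℓ≰0 = advance t₀≤t t<t⁺ (λ t<s s<t⁺ → ca≈u t<s (proj₁ s<t⁺))
        (λ s≈t⁺ → ca≈u (<-respʳ-≈ (sym s≈t⁺) t<t⁺) (≤-reflexive s≈t⁺))
        ≤-refl (λ _ → ≤-refl) slope-g⁺ G≈ G⁺≈ t⁺≤T isBest
        where
        t<t⁺ : t < t⁺
        t<t⁺ = <-from-difference (≰⇒> ℓ≰0) refl
      ... | yes ℓ≤0 = stay isBest
        where
        ℓ≈0 : ℓ ≈ 0#
        ℓ≈0 = antisym ℓ≤0 0≤ℓ
        t⁺≈t : t⁺ ≈ t
        t⁺≈t = trans (+-congˡ ℓ≈0) (+-identityʳ t)
        stay : Best t (u + G) best → Best t⁺ (u + G⁺) best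
        stay (mkBest t₀≤best best≤t attained beats limit) = mkBest t₀≤best
          (≤-trans best≤t t≤t⁺) attained
          (λ t₀≤s s≤t⁺ → beats t₀≤s (≤-respʳ-≈ t⁺≈t s≤t⁺))
          (λ t⁺<T → ≤-respʳ-≈
            (+-congˡ (sym (trans (+-congˡ (trans (*-congˡ ℓ≈0) (zeroʳ γ))) (+-identityʳ G))))
            (limit (<-respˡ-≈ t⁺≈t t⁺<T)))

    -- Lower semicontinuity enters on both sides of `p`: `left-limit` and `right-limit` bound the
    -- value at the jump by its neighbours, as `advance` demands.
    jump-step : ∀ {t G u p v w js cell cs best} →
      State ((t , G) , (u , (p , v , w) ∷ js) , cell ∷ cs , best) → p ≤ t + proj₁ cell →
      State (value (scanJump v₀ v₁ v₂ v₃ v₄)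
        (((t , G) , (u , (p , v , w) ∷ js) , cell ∷ cs , best) ∷ cell ∷ cs ∷ (p , v , w) ∷ js ∷ []))
    jump-step {t} {G} {u} {p} {v} {w} {js} {cell@(ℓ , α , γ)}
              (mk t₀≤t (go {t′ = t′} ((0≤ℓ , t+ℓ≈t′) , slope-a , slope-g) path) G≈ ca≈
                  sorted (t<p ∷ _) (p≤T ∷ jumps≤T) isBest)
              p≤t⁺ =
      mk (≤-trans t₀≤t (proj₁ t<p))
         (go ((≤-respʳ-≈ rest≈ (x≤y⇒0≤y-x p≤t⁺) ,
               trans (solve 3 (λ p t ℓ → p :+ (ℓ :- (p :- t)) := t :+ ℓ) refl p t ℓ) t+ℓ≈t′) ,
              SlopeOn-⊆ {A} (proj₁ t<p) ≤-refl slope-a ,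
              SlopeOn-⊆ {g} (proj₁ t<p) ≤-refl slope-g) path)
         G⁺≈ ca≈⁺ (sorted-tail sorted) (sorted-above sorted) jumps≤T
         (advance t₀≤t t<p ca≈u ca≈v
           (left-limit t₀≤t t<p p≤T (sym (ca≈v refl)) ca≈u)
           (λ p<T → right-limit (≤-trans t₀≤t (proj₁ t<p)) p<T (sorted-above sorted) (sym (ca≈v refl))
             (λ p<s s≤T s<js → trans (ca≈⁺ p<s s≤T) (evalStep-before w js s<js)))
           (SlopeOn-⊆ {g} ≤-refl p≤t′ slope-g) G≈ G⁺≈ p≤T isBest)
      where
      p≤t′ : p ≤ t′
      p≤t′ = ≤-respʳ-≈ t+ℓ≈t′ p≤t⁺
      rest≈ : t + ℓ - p ≈ ℓ - (p - t)
      rest≈ = solve 3 (λ p t ℓ → t :+ ℓ :- p := ℓ :- (p :- t)) refl p t ℓ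
      G⁺≈ : G + γ * (p - t) ≈ g p - g t₀
      G⁺≈ = moved-cost slope-g G≈ (proj₁ t<p) p≤t′ refl
      ca≈⁺ : ∀ {s} → p < s → s ≤ T → ca s ≈ evalStep w js s
      ca≈⁺ p<s s≤T = trans (ca≈ (<-trans t<p p<s) s≤T) (evalStep-after u p v w js p<s)
      ca≈v : ∀ {s} → s ≈ p → ca s ≈ v
      ca≈v s≈p = trans (ca≈ (<-respʳ-≈ (sym s≈p) t<p) (≤-respˡ-≈ (sym s≈p) p≤T))
        (evalStep-at u p v w js s≈p)
      ca≈u : ∀ {s} → t < s → s < p → ca s ≈ u
      ca≈u t<s s<p = trans (ca≈ t<s (≤-trans (proj₁ s<p) p≤T))
        (evalStep-before u ((p , v , w) ∷ js)
          (s<p ∷ All.map (<-trans s<p) (sorted-above sorted)))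

    remaining : Val ScanTy → ℕ
    remaining st = pending (proj₂ (proj₁ (proj₂ st))) (proj₁ (proj₂ (proj₂ st)))

    step-preserve : ∀ st → State st →
      State (value scanStep (st ∷ [])) × remaining (value scanStep (st ∷ [])) ℕ.≤ ℕ.pred (remaining st)
    step-preserve (_ , (_ , _) , [] , _) inv = inv , ℕ.z≤n
    step-preserve (_ , (u , []) , cell ∷ cs , best) inv = cell-step inv [] , pending≤ [] cs
    step-preserve ((t , G) , (u , (p , v , w) ∷ js) , cell ∷ cs , best) inv with p ≤? (t + proj₁ cell)
    ... | yes p≤t⁺ = jump-step inv p≤t⁺ , ℕ.≤-refl
    ... | no  p≰t⁺ =
      cell-step inv (≰⇒> p≰t⁺ ∷ All.map (<-trans (≰⇒> p≰t⁺)) (sorted-above (State′.sorted inv))) ,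
      ℕ.≤-trans (pending≤ ((p , v , w) ∷ js) cs)
        (ℕ.≤-reflexive (≡.sym (ℕ.+-suc (List.length js) (List.length cs))))

    abstract
      scan-correct : ∀ st → State st → IsLeastMinimizer [ t₀ ⋯ T ] f (value scan (st ∷ []))
      scan-correct st inv = result _ (exhaust-preserve scanStep State remaining step-preserve
          (snd (fst (snd v₀))) (fst (snd (snd v₀))) st inv
          (pending≤ (proj₂ (proj₁ (proj₂ st))) (proj₁ (proj₂ (proj₂ st)))))
        where
        result : ∀ st → State st × remaining st ≡.≡ 0 →
                 IsLeastMinimizer [ t₀ ⋯ T ] f (proj₁ (proj₂ (proj₂ (proj₂ st))))
        result (_ , (_ , []) , _ ∷ _ , _) (_ , ())
        result (_ , (_ , _ ∷ _) , _ ∷ _ , _) (_ , ())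
        result (_ , _ , [] , best) (mk _ (stop t≈T) _ _ _ _ _
                                      (mkBest t₀≤best best≤t attained beats _) , _) =
          ((t₀≤best , ≤-respʳ-≈ t≈T best≤t) , λ {s} s∈ → ≤-trans attained (Beats⇒≤ (beats-all s∈))) ,
          λ {s} (s∈ , s-min) → earlier (beats-all s∈)
            (s-min (t₀≤best , ≤-respʳ-≈ t≈T best≤t))
          where
          beats-all : ∀ {s} → [ t₀ ⋯ T ] s → Beats best (s , f s)
          beats-all (t₀≤s , s≤T) = beats t₀≤s (≤-respʳ-≈ (sym t≈T) s≤T)
          earlier : ∀ {s} → Beats best (s , f s) → f s ≤ f (proj₁ best) → proj₁ best ≤ s
          earlier (inj₂ (_ , best≤s)) _    = best≤s
          -- A minimizer cannot be beaten strictly, because its value is at most that of `f` at the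
          -- candidate.
          earlier (inj₁ v<fs)         fs≤f = contradiction (≤-trans fs≤f attained) (<⇒≱ v<fs)

      init-state : ∀ cs → t₀ ≤ T → Path A g t₀ cs T →
        State (value scanInit ((t₀ , (d.initial , d.jumps) , cs) ∷ []))
      init-state cs t₀≤T path = initial d.initial d.jumps d.sorted d.inDomain (λ _ → refl)
        where
        G₀≈ : 0# ≈ g t₀ - g t₀
        G₀≈ = sym (-‿inverseʳ (g t₀))
        first : ∀ {v l} → (∀ {s} → s ≈ t₀ → ca s ≈ v) → (t₀ < T → v ≤ l) →
                Best t₀ (l + 0#) (t₀ , v)
        first {v} {l} ca≈v v≤l = mkBest ≤-refl ≤-refl (≤-reflexive (f≈v ≤-refl refl))
          (λ t₀≤s s≤t₀ → inj₂ (≤-reflexive (sym (f≈v t₀≤s (antisym s≤t₀ t₀≤s))) , t₀≤s))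
          (λ t₀<T → ≤-respʳ-≈ (sym (+-identityʳ l)) (v≤l t₀<T))
          where
          f≈v : ∀ {s} → t₀ ≤ s → s ≈ t₀ → f s ≈ v
          f≈v {s} t₀≤s s≈t₀ = trans (+-cong (ca≈v s≈t₀)
            (trans (+-congʳ (g-cong t₀≤s s≈t₀)) (-‿inverseʳ (g t₀)))) (+-identityʳ v)
        initial : ∀ u js → StrictlySorted (List.map proj₁ js) →
          All [ t₀ ⋯ T ] (List.map proj₁ js) → (∀ s → ca s ≈ evalStep u js s) →
          State (value scanInit ((t₀ , (u , js) , cs) ∷ []))
        initial u [] sorted in-domain ca≈ = mk ≤-refl path G₀≈ (λ {s} _ _ → ca≈ s) sorted [] []
          (first (λ {s} _ → ca≈ s) (λ _ → ≤-refl))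
        initial u ((p , v , w) ∷ js) sorted ((t₀≤p , p≤T) ∷ in-domain) ca≈ with p ≤? t₀
        ... | no p≰t₀ = mk ≤-refl path G₀≈ (λ {s} _ _ → ca≈ s) sorted jumps>t₀
            (p≤T ∷ All.map proj₂ in-domain)
            (first (λ {s} s≈t₀ → trans (ca≈ s) (evalStep-before u ((p , v , w) ∷ js)
                     (All.map (<-respˡ-≈ (sym s≈t₀)) jumps>t₀)))
                   (λ _ → ≤-refl))
          where
          jumps>t₀ : All (t₀ <_) (p ∷ List.map proj₁ js)
          jumps>t₀ = ≰⇒> p≰t₀ ∷ All.map (<-trans (≰⇒> p≰t₀)) (sorted-above sorted)
        -- The jump at the start is consumed at once: its own value is the first candidate, bounded
        -- by the value to its right.
        ... | yes p≤t₀ = mk ≤-refl path G₀≈ (λ t₀<s _ → ca≈⁺ (<-respˡ-≈ (sym p≈t₀) t₀<s))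
            (sorted-tail sorted) (All.map (<-respˡ-≈ p≈t₀) (sorted-above sorted))
            (All.map proj₂ in-domain)
            (first ca≈v (λ t₀<T → right-limit ≤-refl t₀<T
              (All.map (<-respˡ-≈ p≈t₀) (sorted-above sorted)) (sym (ca≈v refl))
              (λ t₀<s s≤T s<js → trans (ca≈⁺ (<-respˡ-≈ (sym p≈t₀) t₀<s)) (evalStep-before w js s<js))))
          where
          p≈t₀ : p ≈ t₀
          p≈t₀ = antisym p≤t₀ t₀≤p
          ca≈v : ∀ {s} → s ≈ t₀ → ca s ≈ v
          ca≈v {s} s≈t₀ = trans (ca≈ s) (evalStep-at u p v w js (trans s≈t₀ (sym p≈t₀)))
          ca≈⁺ : ∀ {s} → p < s → ca s ≈ evalStep w js s
          ca≈⁺ {s} p<s = trans (ca≈ s) (evalStep-after u p v w js p<s)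

-- Cost of the program

module Costs {c ℓ₁ ℓ₂ : Level} (K : OrderedField c ℓ₁ ℓ₂) where

  open RealRAM K
  open Execution K
  open Functions K using (Point; ArrivalTimeFunction; PiecewiseConstant; NonDecreasingPL)
  open PiecewiseLinear K using (risingSlopes; fallingSlopes; slopes-loop; slopes-value)
  private
    module K = OrderedField K

  -- A record rather than an inequality, so that k can be inferred.
  record Within (N k x : ℕ) : Set where
    constructor within
    field
      bound : x ℕ.≤ k ℕ.* N
  open Within

  -- Certificates for a running time of at most k * N.
  data Cost (N : ℕ) : Term Γ τ → Env Γ → ℕ → Set (Level.suc Level.zero ⊔ c) where
    at-most : ∀ {t : Term Γ τ} {ρ k} → Within N k (time t ρ) → Cost N t ρ k
    loop-free : ∀ {t : Term Γ τ} {ρ} → LoopFree t → Cost N t ρ (timeBound t)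
    let-in : ∀ {e : Term Γ σ} {b : Term (σ ∷ Γ) τ} {ρ k l} →
      Cost N e ρ k → Cost N b (value e ρ ∷ ρ) l → Cost N (let-in e b) ρ (1 ℕ.+ k ℕ.+ l)
    call : ∀ {p : Program σ τ} {e : Term Γ σ} {ρ k l} →
      Cost N e ρ k → Cost N p (value e ρ ∷ []) l → Cost N (call p e) ρ (1 ℕ.+ k ℕ.+ l)
    if : ∀ {e f : Term Γ real} {g h : Term Γ τ} {ρ k l} →
      LoopFree e × LoopFree f → Cost N g ρ k → Cost N h ρ l →
      Cost N (if e ≤ f then g else h) ρ (1 ℕ.+ timeBound e ℕ.+ timeBound f ℕ.+ (k ℕ.+ l))
    pair : ∀ {e : Term Γ σ} {f : Term Γ τ} {ρ k l} →
      Cost N e ρ k → Cost N f ρ l → Cost N (pair e f) ρ (1 ℕ.+ k ℕ.+ l)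
    fst : ∀ {e : Term Γ (σ ⊗ τ)} {ρ k} → Cost N e ρ k → Cost N (fst e) ρ (1 ℕ.+ k)
    snd : ∀ {e : Term Γ (σ ⊗ τ)} {ρ k} → Cost N e ρ k → Cost N (snd e) ρ (1 ℕ.+ k)
    case-cons : ∀ {e : Term Γ (list σ)} {f : Term Γ τ} {g : Term (σ ∷ list σ ∷ Γ) τ} {ρ x xs l} →
      value e ρ ≡.≡ x ∷ xs → LoopFree e → Cost N g (x ∷ xs ∷ ρ) l →
      Cost N (case-list e f g) ρ (1 ℕ.+ timeBound e ℕ.+ l)
    for-each : ∀ {e : Term Γ (list σ)} {s : Term Γ τ} {b : Term (σ ∷ τ ∷ Γ) τ} {ρ m q} →
      LoopFree e × LoopFree s → (∀ (st : Val τ) (x : Val σ) → time b (x ∷ st ∷ ρ) ℕ.≤ m) →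
      Within N q (List.length (value e ρ) ℕ.* ℕ.suc m) →
      Cost N (for-each e s b) ρ (1 ℕ.+ timeBound e ℕ.+ timeBound s ℕ.+ q)

  infixl 6 _⊕_
  _⊕_ : ∀ {N x y k l} → Within N k x → Within N l y → Within N (k ℕ.+ l) (x ℕ.+ y)
  _⊕_ {N} {k = k} {l} (within x≤) (within y≤) = within
    (ℕ.≤-trans (ℕ.+-mono-≤ x≤ y≤) (ℕ.≤-reflexive (≡.sym (ℕ.*-distribʳ-+ N k l))))

  module _ {N : ℕ} (1≤N : 1 ℕ.≤ N) where

    constant : ∀ {x} k → x ℕ.≤ k → Within N k x
    constant k x≤k = within (ℕ.≤-trans x≤k
      (ℕ.≤-trans (ℕ.≤-reflexive (≡.sym (ℕ.*-identityʳ k))) (ℕ.*-monoʳ-≤ k 1≤N)))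

    one-step : Within N 1 1
    one-step = constant 1 ℕ.≤-refl

    straight : ∀ (t : Term Γ τ) → LoopFree t → ∀ {ρ} → Within N (timeBound t) (time t ρ)
    straight t lf {ρ} = constant (timeBound t) (time≤timeBound t lf ρ)

    Cost⇒Within : ∀ {t : Term Γ τ} {ρ k} → Cost N t ρ k → Within N k (time t ρ)
    Cost⇒Within (at-most t≤)            = t≤
    Cost⇒Within (loop-free {t = t} lf)  = straight t lf
    Cost⇒Within (let-in e b)            = one-step ⊕ Cost⇒Within e ⊕ Cost⇒Within b
    Cost⇒Within (call e p)              = one-step ⊕ Cost⇒Within e ⊕ Cost⇒Within p
    Cost⇒Within (pair e f)              = one-step ⊕ Cost⇒Within e ⊕ Cost⇒Within f
    Cost⇒Within (fst e)                 = one-step ⊕ Cost⇒Within e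
    Cost⇒Within (snd e)                 = one-step ⊕ Cost⇒Within e
    Cost⇒Within (if {e = e} {f} {ρ = ρ} {k} {l} (le , lf) cg ch) with value e ρ K.≤? value f ρ
    ... | yes _ = one-step ⊕ straight e le ⊕ straight f lf ⊕
      within (ℕ.≤-trans (bound (Cost⇒Within cg)) (ℕ.*-monoˡ-≤ N (ℕ.m≤m+n k l)))
    ... | no  _ = one-step ⊕ straight e le ⊕ straight f lf ⊕
      within (ℕ.≤-trans (bound (Cost⇒Within ch)) (ℕ.*-monoˡ-≤ N (ℕ.m≤n+m l k)))
    Cost⇒Within (case-cons {e = e} {ρ = ρ} eq le cg) with value e ρ | eq
    ... | _ | ≡.refl = one-step ⊕ straight e le ⊕ Cost⇒Within cg
    Cost⇒Within (for-each {e = e} {s} {b} {ρ} (le , ls) b≤ q≤) = within (ℕ.≤-trans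
      (for-each-time e s b ρ b≤)
      (bound (one-step ⊕ straight e le ⊕ straight s ls ⊕ q≤)))

    Cost⇒time≤ : ∀ {t : Term Γ τ} {ρ k} → Cost N t ρ k → time t ρ ℕ.≤ k ℕ.* N
    Cost⇒time≤ cost = bound (Cost⇒Within cost)

  scale : ∀ {x y N} k l → x ℕ.≤ k ℕ.* y → y ℕ.≤ l ℕ.* N → Within N (k ℕ.* l) x
  scale {N = N} k l x≤ y≤ = within (ℕ.≤-trans x≤ (ℕ.≤-trans (ℕ.*-monoʳ-≤ k y≤)
    (ℕ.≤-reflexive (≡.sym (ℕ.*-assoc k l N)))))

  module _ (key weight : Program CellTy real) where

    private
      size : Val SweepTy → ℕ
      size (_ , (_ , js) , cs , out) = List.length js ℕ.+ List.length cs ℕ.+ List.length out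

    -- A cut trades one jump for one finished cell and finishing moves a cell across, so the output
    -- is bounded by the jumps and cells present at the start.
    sweepStep-size : ∀ st → size (value (sweepStep key weight) (st ∷ [])) ℕ.≤ size st
    sweepStep-size (_ , (_ , _) , [] , _) = ℕ.≤-refl
    sweepStep-size (_ , (_ , []) , _ ∷ cs , out) =
      ℕ.≤-reflexive (ℕ.+-suc (List.length cs) (List.length out))
    sweepStep-size (κ , (_ , (p , _) ∷ js) , cell ∷ cs , out) with p K.≤? κ
    ... | yes _ = ℕ.n≤1+n _
    ... | no  _ with p K.≤? (κ K.+ value key (cell ∷ []) K.* proj₁ cell)
    ...   | yes _ = ℕ.≤-reflexive
      (ℕ.+-suc (List.length js ℕ.+ ℕ.suc (List.length cs)) (List.length out))
    ...   | no  _ = ℕ.≤-reflexive (≡.trans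
      (≡.cong ℕ.suc (ℕ.+-suc (List.length js ℕ.+ List.length cs) (List.length out)))
      (≡.cong (λ n → ℕ.suc (n ℕ.+ List.length out)) (≡.sym (ℕ.+-suc (List.length js) (List.length cs)))))

    abstract
      sweep-length : ∀ st → List.length (value (sweep key weight) (st ∷ [])) ℕ.≤ size st
      sweep-length st = ℕ.≤-trans (ℕ.m≤n+m _ _) (proj₁
        (exhaust-preserve (sweepStep key weight) (λ st′ → size st′ ℕ.≤ size st) (λ _ → 0)
          (λ st′ ≤st → ℕ.≤-trans (sweepStep-size st′) ≤st , ℕ.z≤n)
          (snd (fst (snd v₀))) (fst (snd (snd v₀))) st ℕ.≤-refl ℕ.z≤n))

  -- `k` is fixed before the input and depends on the program alone; `l` tells how many units `N`
  -- cover the lists.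
  sweep-cost : ∀ key weight → LoopFree (sweepStep key weight) →
    Σ[ k ∈ ℕ ] ∀ {N l} k₀ u js cs out →
      ℕ.suc (List.length js ℕ.+ List.length cs) ℕ.≤ l ℕ.* N →
      Cost N (sweep key weight) ((k₀ , (u , js) , cs , out) ∷ []) (3 ℕ.+ k ℕ.* l)
  sweep-cost key weight step-loop-free = factor , λ {N} {l} k₀ u js cs out size≤ →
    snd (snd (snd (at-most (scale factor l
      (exhaust-time xs ys (sweepStep key weight) _ _ step-loop-free (k₀ , (u , js) , cs , out))
      size≤))))
    where
    xs : Term (SweepTy ∷ []) JumpsTy
    xs = snd (fst (snd v₀))
    ys : Term (SweepTy ∷ []) (list CellTy)
    ys = fst (snd (snd v₀))
    factor : ℕ
    factor = exhaustFactor xs ys (sweepStep key weight) _ _ step-loop-free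

  reverse-cost : ∀ {N l} (xs : Val (list τ)) → ℕ.suc (List.length xs) ℕ.≤ l ℕ.* N →
                 Cost N (reverseᵀ {τ}) (xs ∷ []) (7 ℕ.* l)
  reverse-cost {τ} {l = l} xs size≤ = at-most (scale 7 l (reverseᵀ-time {τ} xs) size≤)

  risingSlopes-length : ∀ m P ps → List.length (proj₂ (risingSlopes m P ps)) ≡.≡ List.length ps
  risingSlopes-length m P []       = ≡.refl
  risingSlopes-length m P (Q ∷ ps) = ≡.cong ℕ.suc (risingSlopes-length m Q ps)

  fallingSlopes-length : ∀ m m₀ P js ps → List.length (proj₂ (fallingSlopes m m₀ P js ps)) ≡.≡
                                          List.length ps ℕ.+ ℕ.suc (List.length js)
  fallingSlopes-length m m₀ P js []       = ≡.refl
  fallingSlopes-length m m₀ P js (Q ∷ ps) =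
    ≡.trans (fallingSlopes-length m _ Q _ ps) (ℕ.+-suc (List.length ps) _)

  ShortSteps : ℕ → Val (StepTy ⊗ StepTy) → Set
  ShortSteps n ((_ , js) , (_ , js′)) = List.length js ℕ.≤ n × List.length js′ ℕ.≤ n

  slopes-short : ∀ m P ps → ShortSteps (ℕ.suc (List.length ps)) (value slopes ((P ∷ ps , m) ∷ []))
  slopes-short m P ps = ≡.subst (ShortSteps (ℕ.suc (List.length ps))) (≡.sym (slopes-value m P ps))
    (ℕ.≤-reflexive (≡.cong ℕ.suc (risingSlopes-length m P ps)) ,
     ℕ.≤-reflexive (≡.trans (fallingSlopes-length m _ P [] ps) (ℕ.+-comm (List.length ps) 1)))

  linear-loop : ∀ {N n} m → n ℕ.≤ N → Within N (ℕ.suc m) (n ℕ.* ℕ.suc m)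
  linear-loop {n = n} m n≤N = within
    (ℕ.≤-trans (ℕ.≤-reflexive (ℕ.*-comm n (ℕ.suc m))) (ℕ.*-monoʳ-≤ (ℕ.suc m) n≤N))

  SlopesEnv : Set c
  SlopesEnv = Env ((real ⊗ real) ∷ SlopesTy ∷ (real ⊗ real) ∷ PointsTy ∷ (PointsTy ⊗ real) ∷ [])

  slopes-cost : Σ[ k ∈ ℕ ] ∀ {N} m P ps → ℕ.suc (List.length ps) ℕ.≤ N →
                Cost N slopes ((P ∷ ps , m) ∷ []) k
  slopes-cost = _ , λ {N} m P ps size≤ →
    case-cons ≡.refl _
      (let-in (for-each _ (λ st x → time≤timeBound (call slopesStep (pair v₀ v₁)) _
                                      (SlopesEnv ∋ (x ∷ st ∷ P ∷ ps ∷ (P ∷ ps , m) ∷ [])))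
                        (linear-loop _ (ℕ.<⇒≤ size≤)))
        (let-in (loop-free _)
          (pair (pair (loop-free _) (call (loop-free _) (reverse-cost {real ⊗ real ⊗ real} {l = 2} _
                  (ℕ.≤-trans (ℕ.≤-reflexive (≡.cong ℕ.suc (rising-length m P ps)))
                    (ℕ.≤-trans (ℕ.+-mono-≤ (ℕ.≤-trans (ℕ.s≤s ℕ.z≤n) size≤) size≤)
                      (ℕ.≤-reflexive (≡.cong (N ℕ.+_) (≡.sym (ℕ.+-identityʳ N)))))))))
                (loop-free _))))
    where
    jumps : ∀ m P ps → Val JumpsTy
    jumps m P ps = proj₁ (proj₂ (value nextSlope ((List.foldl
      (λ st Q → value slopesStep ((Q , st) ∷ [])) ((P , K.0#) , [] , []) ps , m) ∷ [])))
    rising-length : ∀ m P ps → List.length (jumps m P ps) ≡.≡ ℕ.suc (List.length ps)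
    rising-length m P ps = ≡.trans (≡.sym (length-reverse (jumps m P ps)))
      (≡.trans (≡.cong List.length (proj₁ (slopes-loop m K.0# P [] [] ps)))
               (≡.cong ℕ.suc (risingSlopes-length m P ps)))

  two-more : ∀ {j n} → j ℕ.≤ n → ℕ.suc (j ℕ.+ 1) ℕ.≤ 2 ℕ.* ℕ.suc n
  two-more {j} {n} j≤n = ℕ.≤-trans
    (ℕ.≤-reflexive (≡.cong ℕ.suc (ℕ.+-comm j 1)))
    (ℕ.s≤s (ℕ.≤-trans (ℕ.s≤s j≤n) (ℕ.≤-trans (ℕ.m≤n+m (ℕ.suc n) n)
      (ℕ.≤-reflexive (≡.cong (n ℕ.+_) (≡.sym (ℕ.+-identityʳ (ℕ.suc n))))))))

  -- The unit here is the size of a single sweep with c_ot; the loop over the segments converts it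
  -- into the global one.
  segment-cost : Σ[ k ∈ ℕ ] ∀ {n} Q st steps → ShortSteps n steps →
                 Cost (ℕ.suc n) segmentStep ((Q , st , steps) ∷ []) k
  segment-cost = _ , λ Q st steps (js≤ , js′≤) →
    let-in (loop-free _) (pair (loop-free _) (let-in (loop-free _) (if _
      (call (loop-free _) (proj₂ (sweep-cost risingKey risingKey _) {l = 2} _ _ _ _ _ (two-more js≤)))
      (call (loop-free _) (proj₂ (sweep-cost fallingKey fallingKey _) {l = 2} _ _ _ _ _ (two-more js′≤))))))

  one-more : ∀ {j n} o → j ℕ.≤ n → j ℕ.+ 1 ℕ.+ o ℕ.≤ ℕ.suc n ℕ.+ o
  one-more {j} o j≤n = ℕ.+-monoˡ-≤ o (ℕ.≤-trans (ℕ.≤-reflexive (ℕ.+-comm j 1)) (ℕ.s≤s j≤n))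

  segment-length : ∀ {n} Q P out steps → ShortSteps n steps →
    List.length (proj₂ (value segmentStep ((Q , (P , out) , steps) ∷ []))) ℕ.≤
    ℕ.suc n ℕ.+ List.length out
  segment-length {n} (q , z) (p , y) out ((u , js) , (u′ , js′)) (js≤ , js′≤)
    with K.1# K.≤? ((z K.- y) K.* (q K.- p) K.⁻¹)
  ... | yes _ = ℕ.≤-trans
    (sweep-length risingKey risingKey (y K.- p , (u , js) , (_ , _ , K.0#) ∷ [] , out))
    (one-more (List.length out) js≤)
  ... | no  _ = ℕ.≤-trans
    (sweep-length fallingKey fallingKey (p K.- y , (u′ , js′) , (_ , _ , K.0#) ∷ [] , out))
    (one-more (List.length out) js′≤)

  segments-length : ∀ {n} st ps steps → ShortSteps n steps →
    List.length (proj₂ (List.foldl (λ st Q → value segmentStep ((Q , st , steps) ∷ [])) st ps)) ℕ.≤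
    List.length ps ℕ.* ℕ.suc n ℕ.+ List.length (proj₂ st)
  segments-length st [] steps short = ℕ.≤-refl
  segments-length {n} st@(P , out) (Q ∷ ps) steps short = ℕ.≤-trans
    (segments-length (value segmentStep ((Q , st , steps) ∷ [])) ps steps short)
    (ℕ.≤-trans (ℕ.+-monoʳ-≤ (List.length ps ℕ.* ℕ.suc n) (segment-length Q P out steps short))
      (ℕ.≤-reflexive (solve 3 (λ b s o → b :+ (s :+ o) := s :+ b :+ o) ≡.refl
        (List.length ps ℕ.* ℕ.suc n) (ℕ.suc n) (List.length out))))
    where open +-*-Solver using (solve; _:=_; _:+_)

  SegmentEnv : Set c
  SegmentEnv = Env ((real ⊗ real) ∷ ((real ⊗ real) ⊗ list CellTy) ∷ (real ⊗ real) ∷ PointsTy ∷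
                    (PointsTy ⊗ (StepTy ⊗ StepTy)) ∷ [])

  segmentCall-cost : Σ[ k ∈ ℕ ] ∀ {n} st Q P ps p steps → ShortSteps n steps →
    Cost (ℕ.suc n) (call segmentStep (pair v₀ (pair v₁ (snd v₄))))
      (SegmentEnv ∋ (Q ∷ st ∷ P ∷ ps ∷ (p , steps) ∷ [])) k
  segmentCall-cost = _ , λ st Q P ps p steps short →
    call (loop-free _) (proj₂ segment-cost Q st steps short)

  overtimePieces-cost : Σ[ k ∈ ℕ ] ∀ {N n} P ps steps → ShortSteps n steps →
    List.length ps ℕ.* ℕ.suc n ℕ.≤ 2 ℕ.* N → Cost N overtimePieces ((P ∷ ps , steps) ∷ []) k
  overtimePieces-cost = _ , λ {N} {n} P ps steps short size≤ →
    case-cons ≡.refl _ (snd (for-each _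
      (λ st Q → Cost⇒time≤ (ℕ.s≤s ℕ.z≤n)
        (proj₂ segmentCall-cost st Q P ps (P ∷ ps) steps short))
      (quadratic-loop (List.length ps) (proj₁ segmentCall-cost) size≤)))
    where
    quadratic-loop : ∀ {N n} b k → b ℕ.* ℕ.suc n ℕ.≤ 2 ℕ.* N →
      Within N (ℕ.suc k ℕ.* 2) (b ℕ.* ℕ.suc (k ℕ.* ℕ.suc n))
    quadratic-loop {N} {n} b k size≤ = scale {y = b ℕ.* ℕ.suc n} (ℕ.suc k) 2 (ℕ.≤-trans
      (ℕ.*-monoʳ-≤ b (ℕ.+-monoˡ-≤ (k ℕ.* ℕ.suc n) (ℕ.s≤s (ℕ.z≤n {n}))))
      (ℕ.≤-reflexive (solve 3 (λ b k n → b :* (n :+ k :* n) := b :* n :+ k :* (b :* n))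
        ≡.refl b k (ℕ.suc n)))) size≤
      where open +-*-Solver using (solve; _:=_; _:+_; _:*_)

  addStep-cost : ∀ key weight → LoopFree (sweepStep key weight) → ∀ l →
    Σ[ k ∈ ℕ ] ∀ {N} k₀ u js cs → ℕ.suc (List.length js ℕ.+ List.length cs) ℕ.≤ l ℕ.* N →
      Cost N (addStep key weight) ((k₀ , (u , js) , cs) ∷ []) k
  addStep-cost key weight step-loop-free l = _ , λ k₀ u js cs size≤ →
    call (pair (loop-free _) (pair (loop-free _) (pair
           (call (loop-free _) (reverse-cost {CellTy} {l = l} cs
             (ℕ.≤-trans (ℕ.s≤s (ℕ.m≤n+m (List.length cs) (List.length js))) size≤)))
           (loop-free _))))
         (proj₂ (sweep-cost key weight step-loop-free) {l = l} _ _ _ _ _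
           (ℕ.≤-trans (ℕ.≤-reflexive (≡.cong (λ n → ℕ.suc (List.length js ℕ.+ n)) (length-reverse cs)))
             size≤))

  addStep-length : ∀ key weight k₀ u js cs →
    List.length (value (addStep key weight) ((k₀ , (u , js) , cs) ∷ [])) ℕ.≤
    List.length js ℕ.+ List.length cs
  addStep-length key weight k₀ u js cs = ℕ.≤-trans
    (sweep-length key weight (k₀ , (u , js) , List.reverse cs , []))
    (ℕ.≤-reflexive (≡.trans (ℕ.+-identityʳ _)
      (≡.cong (List.length js ℕ.+_) (length-reverse cs))))

  scan-cost : ∀ l → Σ[ k ∈ ℕ ] ∀ {N} tg u js cs best →
    ℕ.suc (List.length js ℕ.+ List.length cs) ℕ.≤ l ℕ.* N →
    Cost N scan ((tg , (u , js) , cs , best) ∷ []) k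
  scan-cost l = _ , λ tg u js cs best size≤ → fst (snd (snd (snd (at-most
    (scale (exhaustFactor xs ys scanStep _ _ _) l
      (exhaust-time xs ys scanStep _ _ _ (tg , (u , js) , cs , best)) size≤)))))
    where
    xs : Term (ScanTy ∷ []) JumpsTy
    xs = snd (fst (snd v₀))
    ys : Term (ScanTy ∷ []) (list CellTy)
    ys = fst (snd (snd v₀))

  initialised-cost : ∀ l {N} x →
    ℕ.suc (List.length (proj₂ (proj₁ (proj₂ x))) ℕ.+ List.length (proj₂ (proj₂ x))) ℕ.≤ l ℕ.* N →
    Cost N scan (value scanInit (x ∷ []) ∷ []) (proj₁ (scan-cost l))
  initialised-cost l (t , (u , []) , cs) size≤ = proj₂ (scan-cost l) _ _ _ _ _ size≤
  initialised-cost l (t , (u , (p , _) ∷ js) , cs) size≤ with p K.≤? t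
  ... | yes _ = proj₂ (scan-cost l) _ _ _ _ _ (ℕ.≤-trans (ℕ.n≤1+n _) size≤)
  ... | no  _ = proj₂ (scan-cost l) _ _ _ _ _ size≤

  module _ (P : Point) (ps : List Point) (Q : Point) (qs : List Point) (m uw : K.Carrier)
           (jw : Val JumpsTy) where

    private
      nA nO nW : ℕ
      nA = ℕ.suc (List.length ps)
      nO = ℕ.suc (List.length qs)
      nW = List.length jw

    overtimeCells clockCells arrivalCells : List (Val CellTy)
    overtimeCells = value overtimePieces ((P ∷ ps , value slopes ((Q ∷ qs , m) ∷ [])) ∷ [])
    clockCells    = value (addStep clockKey clockWeight) ((proj₁ P , (uw , jw) , overtimeCells) ∷ [])
    arrivalCells  = value (addStep arrivalKey arrivalKey) ((proj₂ P , (uw , jw) , clockCells) ∷ [])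

    module _ {N : ℕ} (size≤ : nO ℕ.* nA ℕ.+ nW ℕ.≤ N) where

      private
        nOnA≤N : nO ℕ.* nA ℕ.≤ N
        nOnA≤N = ℕ.≤-trans (ℕ.m≤m+n _ nW) size≤
        nO≤N : nO ℕ.≤ N
        nO≤N = ℕ.≤-trans (ℕ.m≤m*n nO nA) nOnA≤N
        nA≤N : nA ℕ.≤ N
        nA≤N = ℕ.≤-trans (ℕ.m≤n*m nA nO) nOnA≤N
        nW≤N : nW ℕ.≤ N
        nW≤N = ℕ.≤-trans (ℕ.m≤n+m nW _) size≤

      1≤N : 1 ℕ.≤ N
      1≤N = ℕ.≤-trans (ℕ.s≤s ℕ.z≤n) nO≤N

      add≤ : ∀ {x y} l → x ℕ.≤ N → y ℕ.≤ l ℕ.* N → x ℕ.+ y ℕ.≤ ℕ.suc l ℕ.* N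
      add≤ l x≤ y≤ = ℕ.+-mono-≤ x≤ y≤

      -- The product is at most `nA + nO * nA`, and either summand is at most `N`.
      overtime-size : List.length ps ℕ.* ℕ.suc nO ℕ.≤ 2 ℕ.* N
      overtime-size = ℕ.≤-trans (ℕ.*-monoˡ-≤ (ℕ.suc nO) (ℕ.n≤1+n (List.length ps)))
        (ℕ.≤-trans (ℕ.≤-reflexive (ℕ.*-comm nA (ℕ.suc nO)))
          (add≤ 1 nA≤N (ℕ.≤-trans nOnA≤N (ℕ.≤-reflexive (≡.sym (ℕ.+-identityʳ N))))))

      overtimeCells-length : List.length overtimeCells ℕ.≤ 2 ℕ.* N
      overtimeCells-length = ℕ.≤-trans
        (segments-length (P , []) ps (value slopes ((Q ∷ qs , m) ∷ [])) (slopes-short m Q qs))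
        (ℕ.≤-trans (ℕ.≤-reflexive (ℕ.+-identityʳ _)) overtime-size)

      -- A sweep over the jumps of c_wt adds at most `nW` cells, which raises the factor by 1.
      clockCells-length : List.length clockCells ℕ.≤ 3 ℕ.* N
      clockCells-length = ℕ.≤-trans
        (addStep-length clockKey clockWeight (proj₁ P) uw jw overtimeCells)
        (add≤ 2 nW≤N overtimeCells-length)

      arrivalCells-length : List.length arrivalCells ℕ.≤ 4 ℕ.* N
      arrivalCells-length = ℕ.≤-trans
        (addStep-length arrivalKey arrivalKey (proj₂ P) uw jw clockCells)
        (add≤ 3 nW≤N clockCells-length)

      suc≤ : ∀ {x} l → x ℕ.≤ l ℕ.* N → ℕ.suc x ℕ.≤ ℕ.suc l ℕ.* N
      suc≤ l = add≤ l 1≤N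

  cells-cost : Σ[ k ∈ ℕ ] ∀ {N} P ps ca Q qs m uw jw →
    ℕ.suc (List.length qs) ℕ.* ℕ.suc (List.length ps) ℕ.+ List.length jw ℕ.≤ N →
    Cost N cells ((P ∷ ps , ca , (Q ∷ qs , m) , (uw , jw)) ∷ []) k
  cells-cost = _ , λ P ps ca Q qs m uw jw size≤ → let-in
    (call (pair (loop-free _) (call (loop-free _) (proj₂ slopes-cost m Q qs
            (ℕ.≤-trans (ℕ.m≤m*n (ℕ.suc (List.length qs)) (ℕ.suc (List.length ps)))
                       (ℕ.≤-trans (ℕ.m≤m+n _ (List.length jw)) size≤)))))
          (proj₂ overtimePieces-cost P ps _ (slopes-short m Q qs)
            (overtime-size P ps Q qs m uw jw size≤)))
    (let-in
      -- 4 consists of 2 for the cells, 1 for the jumps and 1 for the successor; the next sweep has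
      -- one more share of cells, hence 5.
      (call (loop-free _) (proj₂ (addStep-cost clockKey clockWeight _ 4) _ _ _ _
        (suc≤ P ps Q qs m uw jw size≤ 3 (add≤ P ps Q qs m uw jw size≤ 2
          (ℕ.≤-trans (ℕ.m≤n+m (List.length jw) _) size≤)
          (overtimeCells-length P ps Q qs m uw jw size≤)))))
      (call (loop-free _) (proj₂ (addStep-cost arrivalKey arrivalKey _ 5) _ _ _ _
        (suc≤ P ps Q qs m uw jw size≤ 4 (add≤ P ps Q qs m uw jw size≤ 3
          (ℕ.≤-trans (ℕ.m≤n+m (List.length jw) _) size≤)
          (clockCells-length P ps Q qs m uw jw size≤))))))

  abstract
    cells-length : ∀ {N} P ps ca Q qs m uw jw →
      ℕ.suc (List.length qs) ℕ.* ℕ.suc (List.length ps) ℕ.+ List.length jw ℕ.≤ N →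
      List.length (value cells ((P ∷ ps , ca , (Q ∷ qs , m) , (uw , jw)) ∷ [])) ℕ.≤ 4 ℕ.* N
    cells-length P ps ca Q qs m uw jw size≤ = arrivalCells-length P ps Q qs m uw jw size≤

  scanInput-cost : Σ[ k ∈ ℕ ] ∀ {N} P ps ca Q qs m uw jw →
    ℕ.suc (List.length qs) ℕ.* ℕ.suc (List.length ps) ℕ.+ List.length jw ℕ.≤ N →
    Cost N scanInput ((P ∷ ps , ca , (Q ∷ qs , m) , (uw , jw)) ∷ []) k
  scanInput-cost = _ , λ P ps ca Q qs m uw jw size≤ →
    pair (loop-free _) (pair (loop-free _)
      (call (call (loop-free _) (proj₂ cells-cost P ps ca Q qs m uw jw size≤))
            (reverse-cost {CellTy} {l = 5} _ (suc≤ P ps Q qs m uw jw size≤ 4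
              (cells-length P ps ca Q qs m uw jw size≤)))))

  abstract
    scanInput-size : ∀ P ps uc jc Q qs m uw jw →
      let nOnA  = ℕ.suc (List.length qs) ℕ.* ℕ.suc (List.length ps)
          x     = value scanInput ((P ∷ ps , (uc , jc) , (Q ∷ qs , m) , (uw , jw)) ∷ [])
      in ℕ.suc (List.length (proj₂ (proj₁ (proj₂ x))) ℕ.+ List.length (proj₂ (proj₂ x))) ℕ.≤
         6 ℕ.* (nOnA ℕ.+ List.length jc ℕ.+ List.length jw)
    scanInput-size P ps uc jc Q qs m uw jw =
      -- 6 consists of 4 for the cells, 1 for the jumps of c_a and 1 for the successor.
      suc≤ P ps Q qs m uw jw size≤ 5 (add≤ P ps Q qs m uw jw size≤ 4
        (ℕ.≤-trans (ℕ.m≤n+m nC nOnA) (ℕ.m≤m+n (nOnA ℕ.+ nC) nW))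
        (ℕ.≤-trans (ℕ.≤-reflexive (length-reverse (value cells (input ∷ []))))
          (cells-length P ps (uc , jc) Q qs m uw jw size≤)))
      where
      nOnA nC nW : ℕ
      nOnA = ℕ.suc (List.length qs) ℕ.* ℕ.suc (List.length ps)
      nC = List.length jc
      nW = List.length jw
      size≤ : nOnA ℕ.+ nW ℕ.≤ nOnA ℕ.+ nC ℕ.+ nW
      size≤ = ℕ.+-monoˡ-≤ nW (ℕ.m≤m+n nOnA nC)
      input : Val InputTy
      input = P ∷ ps , (uc , jc) , (Q ∷ qs , m) , (uw , jw)

  leastMinimizer-cost : Σ[ k ∈ ℕ ] ∀ P ps uc jc Q qs m uw jw →
    Cost (ℕ.suc (List.length qs) ℕ.* ℕ.suc (List.length ps) ℕ.+ List.length jc ℕ.+ List.length jw)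
      leastMinimizer ((P ∷ ps , (uc , jc) , (Q ∷ qs , m) , (uw , jw)) ∷ []) k
  leastMinimizer-cost = _ , λ P ps uc jc Q qs m uw jw →
    call (call (call (loop-free _) (proj₂ scanInput-cost P ps (uc , jc) Q qs m uw jw
                       (ℕ.+-monoˡ-≤ (List.length jw) (ℕ.m≤m+n _ (List.length jc)))))
               (loop-free _))
      (initialised-cost 6 (value scanInput ((P ∷ ps , (uc , jc) , (Q ∷ qs , m) , (uw , jw)) ∷ []))
        (scanInput-size P ps uc jc Q qs m uw jw))

  abstract
    leastMinimizer-time : Σ[ k ∈ ℕ ] ∀ a c_a c_ot c_wt →
      runningTime leastMinimizer (encode K a c_a c_ot c_wt) ℕ.≤
      k ℕ.* (NonDecreasingPL.size c_ot ℕ.* ArrivalTimeFunction.size a ℕ.+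
             PiecewiseConstant.size c_a ℕ.+ PiecewiseConstant.size c_wt)
    leastMinimizer-time = proj₁ leastMinimizer-cost , λ a c_a c_ot c_wt →
      let module a    = ArrivalTimeFunction a
          module c_a  = PiecewiseConstant c_a
          module c_ot = NonDecreasingPL c_ot
          module c_wt = PiecewiseConstant c_wt
      in Cost⇒time≤ (ℕ.s≤s ℕ.z≤n) {t = leastMinimizer} {ρ = encode K a c_a c_ot c_wt ∷ []}
        (proj₂ leastMinimizer-cost (List⁺.head a.breakpoints) (List⁺.tail a.breakpoints)
          c_a.initial c_a.jumps (List⁺.head c_ot.breakpoints) (List⁺.tail c_ot.breakpoints)
          c_ot.finalSlope c_wt.initial c_wt.jumps)

-- Correctness of the computed minimizer

module Correctness {c ℓ₁ ℓ₂ : Level} (K : OrderedField c ℓ₁ ℓ₂) where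

  open OrderedFieldProperties K
  open RealRAM K
  open Functions K
  open Trajectories K
  open PiecewiseLinear K
  open ContinuousCost K
  open Scanning K

  IsLeastMinimizer-shift : ∀ {D : Domain} {f g : Carrier → Carrier} {t} k →
    (∀ s → g s ≈ f s + k) → IsLeastMinimizer D f t → IsLeastMinimizer D g t
  IsLeastMinimizer-shift k g≈ ((t∈ , t-min) , least) =
    (t∈ , λ {s} s∈ → ≤-respˡ-≈ (sym (g≈ _)) (≤-respʳ-≈ (sym (g≈ s)) (+-monoˡ-≤ k (t-min s∈)))) ,
    λ (s∈ , s-min) → least (s∈ , λ {r} r∈ →
      +-cancelʳ-≤ k (≤-respˡ-≈ (g≈ _) (≤-respʳ-≈ (g≈ r) (s-min r∈))))

  abstract
    leastMinimizer-correct : ∀ a c_a c_ot c_wt →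
      LowerSemicontinuousOn [ tMin a ⋯ tMax a ] (PiecewiseConstant.⟦_⟧ c_a) →
      IsLeastMinimizer [ tMin a ⋯ tMax a ] (totalCost a c_a c_ot c_wt)
        (output leastMinimizer (encode K a c_a c_ot c_wt))
    leastMinimizer-correct a c_a c_ot c_wt lsc =
      -- The scan counts the cost from `t₀` on, hence this constant.
      IsLeastMinimizer-shift (cost₂ t₀)
        (λ s → trans (trans (+-assoc _ _ _) (+-congˡ (cost₂≈ s)))
          (solve 3 (λ d g k → d :+ g := d :+ (g :- k) :+ k)
            refl (PiecewiseConstant.⟦_⟧ c_a s) (cost₂ s) (cost₂ t₀)))
        (scan-correct _ (init-state _ (Path⇒≤ a.⟦_⟧ path) path))
      where
      open Continuous a c_ot c_wt
      open LeastMinimizer cost₂ a.⟦_⟧ t₀ T c_a cost₂-cong lsc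
      path : Path a.⟦_⟧ cost₂ t₀ (List.reverse (value cells (encode K a c_a c_ot c_wt ∷ []))) T
      path = toPath (cells-trail (PiecewiseConstant.initial c_a , PiecewiseConstant.jumps c_a))

open import Data.Nat.Base using (ℕ; _+_; _*_; _≤_)

mainTheorem9 : ∀ {c ℓ₁ ℓ₂ : Level} (K : OrderedField c ℓ₁ ℓ₂) →
    let open RealRAM K
        open Functions K
    in
    Σ[ program ∈ Program InputTy real ] Σ[ C ∈ ℕ ]
      ((a    : ArrivalTimeFunction)
       (c_a  : PiecewiseConstant (tMin a) (tMax a))
       (c_ot : NonDecreasingPL)
       (c_wt : PiecewiseConstant (tMin a) (ArrivalTimeFunction.⟦_⟧ a (tMax a))) →
       LowerSemicontinuousOn [ tMin a ⋯ tMax a ] (PiecewiseConstant.⟦_⟧ c_a) →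
       let input  = encode K a c_a c_ot c_wt
           b-a    = ArrivalTimeFunction.size a
           b-c_a  = PiecewiseConstant.size c_a
           b-c_ot = NonDecreasingPL.size c_ot
           b-c_wt = PiecewiseConstant.size c_wt
       in
       IsLeastMinimizer [ tMin a ⋯ tMax a ] (totalCost a c_a c_ot c_wt) (output program input)
       × runningTime program input ≤ C * (b-c_ot * b-a + b-c_a + b-c_wt))
mainTheorem9 K = leastMinimizer , proj₁ leastMinimizer-time , λ a c_a c_ot c_wt lsc →
  leastMinimizer-correct a c_a c_ot c_wt lsc ,
  proj₂ leastMinimizer-time a c_a c_ot c_wt
  where
  open Costs K
  open Correctness K
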